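{- Let $q\geq 3$ be an integer and let $G$ be a Class 1 graph with $\Delta(G)\geq 5$. If every block of $G$ is either a bipartite graph, or a $(q+1)$-degenerate graph belonging to $\mathcal{A}(q)$, then $\chi'_{trans}(G)\leq q+1$.
   Context: Graphs are finite, without loops and multiple edges. A $t$-coloring of a graph $G$ is a map $f:E(G)\to\{1,\dots,t\}$; it is proper if adjacent edges receive distinct colors. $\chi'(G)$ is the chromatic index and $\Delta(G)$ the maximum degree; $G$ is Class 1 if $\chi'(G)=\Delta(G)$. For a coloring $f$, $M(f,j)$ denotes the set of edges of color $j$. Two $t$-colorings $f,g$ differ by at most $n$ color classes if $|\{j: M(f,j)\neq M(g,j)\}|\leq n$. Two proper $t$-colorings $f,g$ are $n$-equivalent if there is a sequence $f_0=f,f_1,\dots,f_k=g$ ($k\geq 1$) of proper $t$-colorings of $G$ such that $f_i$ differs from $f_{i-1}$ by at most $n$ color classes for $i=1,\dots,k$. $\chi'_{trans}(G)$ is the minimum integer $n\geq 2$ such that any proper $\chi'(G)$-coloring of $G$ is $n$-equivalent to any other proper $\chi'(G)$-coloring of $G$. For an integer $q\geq 2$, $\mathcal{A}(q)$ is the set of graphs $G$ such that every subgraph $H$ of $G$ with $\Delta(H)\leq q$ has a proper $q$-edge-coloring. A graph is $k$-degenerate if every subgraph contains a vertex of degree at most $k$ in that subgraph. A block of $G$ is a maximal connected subgraph of $G$ that has no cutvertex of its own (so each block is a maximal 2-connected subgraph, a bridge with its ends, or an isolated vertex). -}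

module Defs where

open import Data.Nat using (ℕ; zero; suc; _≤_; _⊔_)
open import Data.Fin as Fin using (Fin)
open import Data.Bool using (Bool; true; false; if_then_else_)
open import Data.List using (List; map; foldr; allFin)
open import Data.Nat.ListAction using (sum)
open import Data.Product using (Σ; ∃; _×_; _,_)
open import Data.Sum using (_⊎_)
open import Data.Fin.Subset using (Subset; _∈_; _∉_; ∣_∣)
open import Relation.Nullary using (¬_)
open import Relation.Binary.PropositionalEquality using (_≡_; _≢_)
open import Relation.Binary.Construct.Closure.ReflexiveTransitive using (Star)
open import Function.Bundles using (_⇔_)

-- A finite simple graph whose vertex set is {v : Fin n | V v ≡ true}
-- and whose edge relation is E (symmetric, loopless, edges between vertices).
-- Subgraphs of a graph on Fin n are again SGraph n.
record SGraph (n : ℕ) : Set where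
  field
    V      : Fin n → Bool
    E      : Fin n → Fin n → Bool
    sym    : ∀ u v → E u v ≡ E v u
    irrefl : ∀ v → E v v ≡ false
    closed : ∀ u v → E u v ≡ true → V u ≡ true
open SGraph public

_⊆G_ : ∀ {n} → SGraph n → SGraph n → Set
H ⊆G G = (∀ v → V H v ≡ true → V G v ≡ true)
       × (∀ u v → E H u v ≡ true → E G u v ≡ true)

deg : ∀ {n} → SGraph n → Fin n → ℕ
deg {n} G v = sum (map (λ u → if E G v u then 1 else 0) (allFin n))

MaxDeg : ∀ {n} → SGraph n → ℕ
MaxDeg {n} G = foldr _⊔_ 0 (map (deg G) (allFin n))

record Edge {n : ℕ} (G : SGraph n) : Set where
  constructor edge
  field
    eu  : Fin n
    ev  : Fin n
    u<v : eu Fin.< ev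
    adj : E G eu ev ≡ true
open Edge public

SameEdge : ∀ {n} {G : SGraph n} → Edge G → Edge G → Set
SameEdge e e' = (eu e ≡ eu e') × (ev e ≡ ev e')

Adjacent : ∀ {n} {G : SGraph n} → Edge G → Edge G → Set
Adjacent e e' = ¬ SameEdge e e' ×
  ((eu e ≡ eu e') ⊎ (eu e ≡ ev e') ⊎ (ev e ≡ eu e') ⊎ (ev e ≡ ev e'))

Coloring : ∀ {n} → SGraph n → ℕ → Set
Coloring G t = Edge G → Fin t

Proper : ∀ {n} {G : SGraph n} {t} → Coloring G t → Set
Proper {G = G} f = ∀ (e e' : Edge G) → Adjacent e e' → f e ≢ f e'

PColoring : ∀ {n} → SGraph n → ℕ → Set
PColoring G t = Σ (Coloring G t) Proper

IsChromaticIndex : ∀ {n} → SGraph n → ℕ → Set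
IsChromaticIndex G k = PColoring G k × (∀ t → PColoring G t → k ≤ t)

Class1 : ∀ {n} → SGraph n → Set
Class1 G = IsChromaticIndex G (MaxDeg G)

SameClass : ∀ {n} {G : SGraph n} {t} → Coloring G t → Coloring G t → Fin t → Set
SameClass {G = G} f g j = ∀ (e : Edge G) → (f e ≡ j) ⇔ (g e ≡ j)

DifferAtMost : ∀ {n} {G : SGraph n} {t} → ℕ → Coloring G t → Coloring G t → Set
DifferAtMost {t = t} m f g =
  ∃ λ (S : Subset t) → (∣ S ∣ ≤ m) × (∀ j → j ∉ S → SameClass f g j)

data Equiv {n} (G : SGraph n) (t m : ℕ) : PColoring G t → PColoring G t → Set where
  one  : ∀ {f g} → DifferAtMost m (Data.Product.proj₁ f) (Data.Product.proj₁ g) → Equiv G t m f g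
  more : ∀ {f g h} → Equiv G t m f g
       → DifferAtMost m (Data.Product.proj₁ g) (Data.Product.proj₁ h) → Equiv G t m f h

TransProperty : ∀ {n} → SGraph n → ℕ → Set
TransProperty G m = ∀ k → IsChromaticIndex G k → ∀ (f g : PColoring G k) → Equiv G k m f g

-- χ'_trans(G) ≤ b  (χ'_trans is the least m ≥ 2 with TransProperty)
TransIndexAtMost : ∀ {n} → SGraph n → ℕ → Set
TransIndexAtMost G b = ∃ λ m → (2 ≤ m) × (m ≤ b) × TransProperty G m

Step : ∀ {n} → SGraph n → Fin n → Fin n → Set
Step G a b = E G a b ≡ true

Connected : ∀ {n} → SGraph n → Set
Connected G = ∀ a b → V G a ≡ true → V G b ≡ true → Star (Step G) a b

StepAvoid : ∀ {n} → SGraph n → Fin n → Fin n → Fin n → Set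
StepAvoid G v a b = (E G a b ≡ true) × (a ≢ v) × (b ≢ v)

NoCutvertex : ∀ {n} → SGraph n → Set
NoCutvertex G = ∀ v → V G v ≡ true → ∀ a b → V G a ≡ true → V G b ≡ true
  → a ≢ v → b ≢ v → Star (StepAvoid G v) a b

BlockLike : ∀ {n} → SGraph n → Set
BlockLike B = Connected B × NoCutvertex B

IsBlock : ∀ {n} → SGraph n → SGraph n → Set
IsBlock G B = (B ⊆G G) × BlockLike B
  × (∀ H → B ⊆G H → H ⊆G G → BlockLike H → H ⊆G B)

Bipartite : ∀ {n} → SGraph n → Set
Bipartite G = ∃ λ (c : Fin _ → Bool) → ∀ u v → E G u v ≡ true → c u ≢ c v

Degenerate : ∀ {n} → ℕ → SGraph n → Set
Degenerate k G = ∀ H → H ⊆G G → (∃ λ v → V H v ≡ true)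
  → ∃ λ v → (V H v ≡ true) × (deg H v ≤ k)

InA : ∀ {n} → ℕ → SGraph n → Set
InA q G = ∀ H → H ⊆G G → MaxDeg H ≤ q → PColoring H q

{-# OPTIONS --safe #-}
module Submission where

-- Colouring the blocks one by one and permuting colours at cutvertices shows
-- (with König's theorem for the bipartite blocks) that G itself lies in A(q).
-- Lump q of the colours into a single colour 0, whose class F only has maximum
-- degree at most q: since G is in A(q), every lumped colouring can be refined to
-- a proper one, and changing F together with one further class C changes at
-- most q + 1 classes.  So it suffices to connect lumped colourings by such moves.
--
-- To create a prescribed class M (a class of the target colouring), keep a
-- matching N inside F that meets all vertices of degree q in F except those of
-- a set D with at most 2 elements, and turn N into M along alternating paths
-- with D as the set of open ends.  A step changes N to a matching N' of F ∪ C;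
-- it is realised by a new class C' taken from a q-edge-colouring of
-- (F ∪ C) ∖ N' minus one edge at each vertex of D.  Each deleted edge spoils at
-- most one of the q ≥ 3 > |D| colours, so some colour class C' meets every
-- vertex that has to lose an edge.  Once N = M and D is empty, M can replace a
-- class, and the remaining classes are treated by induction.

open import Defs
open import Data.Bool using (Bool; true; false; _∧_; _∨_; not; _xor_; if_then_else_)
open import Data.Bool.Properties using (∧-conicalˡ; ∧-conicalʳ; ∧-identityʳ; ∧-zeroʳ; ¬-not; ⇔→≡)
open import Data.Empty using (⊥; ⊥-elim)
open import Data.Fin as Fin using (Fin; zero; suc; toℕ; fromℕ<; combine; remQuot)
open import Data.Fin.Properties as Finₚ using (remQuot-combine)
open import Data.Fin.Subset as Subset using (∣_∣)
open import Data.Fin.Subset.Properties as Subsetₚ using ()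
open import Data.List using (List; []; _∷_; _++_; length; map; foldr; tabulate; allFin)
open import Data.List.Membership.Propositional using (_∈_)
open import Data.List.Membership.Propositional.Properties using (∈-++⁺ˡ; ∈-++⁺ʳ)
open import Data.List.Properties using (length-++)
open import Data.List.Relation.Unary.Any using (here; there)
open import Data.Nat as ℕ using (ℕ; zero; suc; _+_; _∸_; _⊔_; _≤_; _<_; z≤n; s≤s; s≤s⁻¹)
open import Data.Nat.ListAction using (sum)
open import Data.Nat.Properties as ℕₚ using (≤-refl; ≤-trans; ≤-reflexive; ≤-<-trans; <⇒≱; ≰⇒>; n≮n; n≤0⇒n≡0; +-suc; +-comm; +-mono-≤; +-monoʳ-≤; m≤m+n)
open import Data.Product using (∃; ∃₂; _×_; _,_; proj₁; proj₂)
open import Data.Sum as Sum using (_⊎_; inj₁; inj₂; [_,_]′)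
open import Data.Vec as Vec using ()
open import Data.Vec.Properties using (lookup⇒[]=; lookup∘tabulate)
open import Function using (_∘_; const)
open import Function.Bundles using (mk⇔)
open import Relation.Binary.Construct.Closure.ReflexiveTransitive as Star using (Star; ε; _◅_; _◅◅_)
open import Relation.Binary.Definitions using (tri<; tri≈; tri>)
open import Relation.Binary.PropositionalEquality using (_≡_; _≢_; refl; trans; cong; cong₂; subst; subst₂) renaming (sym to ≡-sym)
open import Relation.Nullary using (¬_; Dec; yes; no)
open import Relation.Nullary.Decidable using (⌊_⌋)

-- The obstacle is that A(q) only speaks of subgraphs of maximum degree q, while F ∪ C may contain
-- vertices of degree q + 1. Setting aside a matching that meets those vertices brings the rest
-- within reach of A(q), and every class of a q-edge-colouring of the rest then meets each vertex
-- that still has degree q. This double role is why N must meet the full vertices of F: it makes F ∪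
-- C colourable after its removal, and it lies outside the class chosen as the new C, hence stays in
-- F. Exchanging N for M around one vertex uncovers at most two vertices, and from then on each
-- exchange moves an open end instead of creating one; hence the bound on D. An end where N and M
-- are both absent and F is full cannot be moved any further. There a count helps: M is a class of
-- the target, so a vertex missed by M has degree at most q + m, where m + 1 is the number of single
-- classes; as F takes q of these edges, some single class misses the vertex, and a move with that
-- class closes the end.

-- Booleans and search over finite sets

true⊎false : ∀ b → b ≡ true ⊎ b ≡ false
true⊎false true  = inj₁ refl
true⊎false false = inj₂ refl

true≢false : ∀ {a} {A : Set a} {b} → b ≡ true → b ≡ false → A
true≢false refl ()

∧-intro : ∀ {a b} → a ≡ true → b ≡ true → a ∧ b ≡ true
∧-intro refl refl = refl

∧-fst : ∀ {a b} → a ∧ b ≡ true → a ≡ true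
∧-fst {a} {b} = ∧-conicalˡ a b

∧-snd : ∀ {a b} → a ∧ b ≡ true → b ≡ true
∧-snd {a} {b} = ∧-conicalʳ a b

∨-left : ∀ {a b} → a ≡ true → a ∨ b ≡ true
∨-left refl = refl

∨-right : ∀ {a b} → b ≡ true → a ∨ b ≡ true
∨-right {true}  _ = refl
∨-right {false} p = p

∨-elim : ∀ {a b} → a ∨ b ≡ true → a ≡ true ⊎ b ≡ true
∨-elim {true}  _ = inj₁ refl
∨-elim {false} p = inj₂ p

∨-false : ∀ {a b} → a ≡ false → b ≡ false → a ∨ b ≡ false
∨-false refl refl = refl

not-intro : ∀ {a} → a ≡ false → not a ≡ true
not-intro refl = refl

not-elim : ∀ {a} → not a ≡ true → a ≡ false
not-elim {false} _ = refl

false-intro : ∀ {a} → (a ≡ true → ⊥) → a ≡ false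
false-intro = ¬-not

dec-sound : ∀ {a} {A : Set a} (A? : Dec A) → ⌊ A? ⌋ ≡ true → A
dec-sound (yes a) _ = a

dec-complete : ∀ {a} {A : Set a} (A? : Dec A) → A → ⌊ A? ⌋ ≡ true
dec-complete (yes _) _ = refl
dec-complete (no na) a = ⊥-elim (na a)

_==_ : ∀ {n} → Fin n → Fin n → Bool
u == v = ⌊ u Fin.≟ v ⌋

==-sound : ∀ {n} {u v : Fin n} → (u == v) ≡ true → u ≡ v
==-sound {u = u} {v} = dec-sound (u Fin.≟ v)

==-complete : ∀ {n} {u v : Fin n} → u ≡ v → (u == v) ≡ true
==-complete {u = u} {v} = dec-complete (u Fin.≟ v)

==-refl : ∀ {n} (u : Fin n) → (u == u) ≡ true
==-refl u = ==-complete refl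

≢⇒==-false : ∀ {n} {u v : Fin n} → u ≢ v → (u == v) ≡ false
≢⇒==-false ne = false-intro (ne ∘ ==-sound)

search : ∀ {n} (P : Fin n → Bool) → (∃ λ i → P i ≡ true) ⊎ (∀ i → P i ≡ false)
search {zero} P = inj₂ λ ()
search {suc n} P with true⊎false (P zero)
... | inj₁ p = inj₁ (zero , p)
... | inj₂ p with search (P ∘ suc)
...   | inj₁ (i , q) = inj₁ (suc i , q)
...   | inj₂ q = inj₂ λ { zero → p ; (suc i) → q i }

-- Typically `A i` is a property to be verified and `B` a single kind of counterexample, such as a
-- missing colour or a separation.
finite-choice : ∀ {a b} {n} {A : Fin n → Set a} {B : Set b} → (∀ i → A i ⊎ B) → (∀ i → A i) ⊎ B
finite-choice {n = zero} h = inj₁ λ ()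
finite-choice {n = suc n} h with h zero
... | inj₂ b = inj₂ b
... | inj₁ p with finite-choice (h ∘ suc)
...   | inj₂ b = inj₂ b
...   | inj₁ r = inj₁ λ { zero → p ; (suc i) → r i }

-- Counting the elements of Boolean predicates

bit : Bool → ℕ
bit b = if b then 1 else 0

count : ∀ {n} → (Fin n → Bool) → ℕ
count {zero}  P = 0
count {suc n} P = bit (P zero) + count (P ∘ suc)

count-cong : ∀ {n} {P Q : Fin n → Bool} → (∀ i → P i ≡ Q i) → count P ≡ count Q
count-cong {zero}  h = refl
count-cong {suc n} h = cong₂ _+_ (cong bit (h zero)) (count-cong (h ∘ suc))

bit-≤1 : ∀ b → bit b ≤ 1
bit-≤1 true  = ≤-refl
bit-≤1 false = z≤n

count-≤n : ∀ {n} (P : Fin n → Bool) → count P ≤ n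
count-≤n {zero} P = z≤n
count-≤n {suc n} P = +-mono-≤ (bit-≤1 (P zero)) (count-≤n (P ∘ suc))

count-all : ∀ {n} (P : Fin n → Bool) → (∀ i → P i ≡ true) → n ≤ count P
count-all {zero} P h = z≤n
count-all {suc n} P h rewrite h zero = s≤s (count-all (P ∘ suc) (h ∘ suc))

count-none : ∀ {n} (P : Fin n → Bool) → (∀ i → P i ≡ false) → count P ≡ 0
count-none {zero} P h = refl
count-none {suc n} P h rewrite h zero = count-none (P ∘ suc) (h ∘ suc)

_-[_] : ∀ {n} → (Fin n → Bool) → Fin n → Fin n → Bool
(P -[ i ]) k = P k ∧ not (k == i)

suc-==-suc : ∀ {n} (k i : Fin n) → (suc k == suc i) ≡ (k == i)
suc-==-suc k i with true⊎false (k == i)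
... | inj₁ p = trans (==-complete (cong suc (==-sound p))) (≡-sym p)
... | inj₂ p = trans (false-intro λ q → true≢false (==-complete (Finₚ.suc-injective (==-sound q))) p) (≡-sym p)

count-remove : ∀ {n} (P : Fin n → Bool) i → P i ≡ true → count P ≡ suc (count (P -[ i ]))
count-remove {suc n} P zero p rewrite p = cong suc (count-cong λ i → ≡-sym (∧-identityʳ (P (suc i))))
count-remove {suc n} P (suc i) p
  rewrite count-remove (P ∘ suc) i p
        | count-cong {P = λ k → P (suc k) ∧ not (suc k == suc i)} {Q = (P ∘ suc) -[ i ]}
            (λ k → cong (λ b → P (suc k) ∧ not b) (suc-==-suc k i))
  with P zero
... | true  = refl
... | false = refl

-- The map takes a membership proof because its values are often witnesses extracted from that
-- proof; injectivity is asked for all choices of proofs.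
count-injective : ∀ {m n} (P : Fin m → Bool) (Q : Fin n → Bool) (φ : ∀ i → P i ≡ true → Fin n)
  → (∀ i p → Q (φ i p) ≡ true)
  → (∀ i k p r → φ i p ≡ φ k r → i ≡ k)
  → count P ≤ count Q
count-injective {zero} P Q φ h inj = z≤n
count-injective {suc m} P Q φ h inj with true⊎false (P zero)
... | inj₂ p rewrite p =
  count-injective (P ∘ suc) Q (φ ∘ suc) (h ∘ suc) (λ i k p r e → Finₚ.suc-injective (inj _ _ p r e))
... | inj₁ p = subst₂ _≤_ (≡-sym (cong (λ b → bit b + count (P ∘ suc)) p)) (≡-sym (count-remove Q y (h zero p)))
  (s≤s (count-injective (P ∘ suc) (Q -[ y ]) (φ ∘ suc)
    (λ i r → ∧-intro (h (suc i) r)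
       (not-intro (≢⇒==-false λ e → Finₚ.0≢1+n (inj zero (suc i) p r (≡-sym e)))))
    (λ i k p r e → Finₚ.suc-injective (inj _ _ p r e))))
  where y = φ zero p

count-mono : ∀ {n} {P Q : Fin n → Bool} → (∀ i → P i ≡ true → Q i ≡ true) → count P ≤ count Q
count-mono {P = P} {Q} h = count-injective P Q (λ i _ → i) h (λ _ _ _ _ e → e)

count-mono-< : ∀ {n} {P Q : Fin n → Bool} → (∀ i → P i ≡ true → Q i ≡ true)
  → ∀ i → P i ≡ false → Q i ≡ true → count P < count Q
count-mono-< {P = P} {Q} h i p r rewrite count-remove Q i r =
  s≤s (count-mono λ k s → ∧-intro (h k s) (not-intro (≢⇒==-false λ { refl → true≢false s p })))

count-≥1 : ∀ {n} (P : Fin n → Bool) i → P i ≡ true → 1 ≤ count P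
count-≥1 P i p rewrite count-remove P i p = s≤s z≤n

count-≤1 : ∀ {n} (P : Fin n → Bool) → (∀ i k → P i ≡ true → P k ≡ true → i ≡ k) → count P ≤ 1
count-≤1 P h = count-injective {n = 1} P (const true) (λ _ _ → zero) (λ _ _ → refl) (λ i k p r _ → h i k p r)

count-witness : ∀ {n} (P : Fin n → Bool) → 1 ≤ count P → ∃ λ i → P i ≡ true
count-witness P h with search P
... | inj₁ w = w
... | inj₂ none rewrite count-none P none with () ← h

count-missing : ∀ {n} (P : Fin n → Bool) → count P < n → ∃ λ i → P i ≡ false
count-missing P h with search (not ∘ P)
... | inj₁ (i , p) = i , not-elim p
... | inj₂ none = ⊥-elim (<⇒≱ h (count-all P λ i → ¬-not λ e → true≢false (not-intro e) (none i)))

count-split : ∀ {n} (P Q : Fin n → Bool)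
  → count P ≡ count (λ i → P i ∧ Q i) + count (λ i → P i ∧ not (Q i))
count-split {zero} P Q = refl
count-split {suc n} P Q with P zero | Q zero
... | false | _     = count-split (P ∘ suc) (Q ∘ suc)
... | true  | true  = cong suc (count-split (P ∘ suc) (Q ∘ suc))
... | true  | false = trans (cong suc (count-split (P ∘ suc) (Q ∘ suc))) (≡-sym (+-suc _ _))

-- Transpositions of colours

swap : ∀ {n} → Fin n → Fin n → Fin n → Fin n
swap a b c = if c == a then b else if c == b then a else c

swap-left : ∀ {n} (a b : Fin n) → swap a b a ≡ b
swap-left a b rewrite ==-refl a = refl

swap-right : ∀ {n} (a b : Fin n) → swap a b b ≡ a
swap-right a b with true⊎false (b == a)
... | inj₁ p rewrite p = ==-sound p
... | inj₂ p rewrite p | ==-refl b = refl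

swap-other : ∀ {n} (a b c : Fin n) → c ≢ a → c ≢ b → swap a b c ≡ c
swap-other a b c na nb rewrite ≢⇒==-false na | ≢⇒==-false nb = refl

swap-involutive : ∀ {n} (a b c : Fin n) → swap a b (swap a b c) ≡ c
swap-involutive a b c = [ at-a , (λ na → [ at-b , other na ]′ (≡⊎≢ c b)) ]′ (≡⊎≢ c a)
  where
  ≡⊎≢ : ∀ x y → x ≡ y ⊎ x ≢ y
  ≡⊎≢ x y with x Fin.≟ y
  ... | yes e = inj₁ e
  ... | no ne = inj₂ ne
  at-a : c ≡ a → swap a b (swap a b c) ≡ c
  at-a refl = trans (cong (swap a b) (swap-left a b)) (swap-right a b)
  at-b : c ≡ b → swap a b (swap a b c) ≡ c
  at-b refl = trans (cong (swap a b) (swap-right a b)) (swap-left a b)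
  other : c ≢ a → c ≢ b → swap a b (swap a b c) ≡ c
  other na nb = trans (cong (swap a b) (swap-other a b c na nb)) (swap-other a b c na nb)

swap-injective : ∀ {n} (a b : Fin n) {c d} → swap a b c ≡ swap a b d → c ≡ d
swap-injective a b {c} {d} e =
  trans (≡-sym (swap-involutive a b c)) (trans (cong (swap a b) e) (swap-involutive a b d))

-- Edge sets and edge colourings

EdgeSet : ℕ → Set
EdgeSet n = Fin n → Fin n → Bool

module _ {n : ℕ} where

  Symmetric Matching : EdgeSet n → Set
  Symmetric F = ∀ u v → F u v ≡ true → F v u ≡ true
  Matching F = ∀ u v w → F u v ≡ true → F u w ≡ true → v ≡ w

  _⊆_ : EdgeSet n → EdgeSet n → Set
  F ⊆ H = ∀ u v → F u v ≡ true → H u v ≡ true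

  _∩_ _∪_ _∖_ : EdgeSet n → EdgeSet n → EdgeSet n
  (F ∩ H) u v = F u v ∧ H u v
  (F ∪ H) u v = F u v ∨ H u v
  (F ∖ H) u v = F u v ∧ not (H u v)

  Covers : EdgeSet n → Fin n → Set
  Covers F z = ∃ λ w → F z w ≡ true

  covers? : ∀ F z → Covers F z ⊎ (∀ w → F z w ≡ false)
  covers? F z = search (F z)

  symmetric-false : ∀ {F} → Symmetric F → ∀ u v → F u v ≡ false → F v u ≡ false
  symmetric-false s u v p = false-intro λ t → true≢false (s v u t) p

  ∩-symmetric : ∀ {F H} → Symmetric F → Symmetric H → Symmetric (F ∩ H)
  ∩-symmetric sF sH u v p = ∧-intro (sF u v (∧-fst p)) (sH u v (∧-snd p))

  ∪-symmetric : ∀ {F H} → Symmetric F → Symmetric H → Symmetric (F ∪ H)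
  ∪-symmetric {F} {H} sF sH u v p with ∨-elim {F u v} p
  ... | inj₁ a = ∨-left (sF u v a)
  ... | inj₂ a = ∨-right {F v u} (sH u v a)

  ∖-symmetric : ∀ {F H} → Symmetric F → Symmetric H → Symmetric (F ∖ H)
  ∖-symmetric {F} {H} sF sH u v p =
    ∧-intro (sF u v (∧-fst p)) (not-intro (symmetric-false sH u v (not-elim (∧-snd {F u v} p))))

  ∖-⊆ : ∀ F H → (F ∖ H) ⊆ F
  ∖-⊆ F H u v = ∧-fst

  degree-split : ∀ F H z → count (F z) ≡ count ((F ∩ H) z) + count ((F ∖ H) z)
  degree-split F H z = count-split (F z) (H z)

  search₂ : (F : EdgeSet n) → (∃₂ λ u v → F u v ≡ true) ⊎ (∀ u v → F u v ≡ false)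
  search₂ F = Sum.swap (finite-choice λ u → [ (λ { (v , p) → inj₂ (u , v , p) }) , inj₁ ]′ (search (F u)))

  -- Counts ordered pairs, coded in `Fin (n * n)`. It serves only as a termination measure.
  size : EdgeSet n → ℕ
  size F = count (λ i → F (proj₁ (remQuot {n} n i)) (proj₂ (remQuot {n} n i)))

  size-mono-< : ∀ {F H} → F ⊆ H → ∀ u v → F u v ≡ false → H u v ≡ true → size F < size H
  size-mono-< {F} {H} s u v p r = count-mono-< (λ i → s _ _) (combine u v)
    (trans (cong (λ x → F (proj₁ x) (proj₂ x)) (remQuot-combine u v)) p)
    (trans (cong (λ x → H (proj₁ x) (proj₂ x)) (remQuot-combine u v)) r)

  size-≥1 : ∀ {F} u v → F u v ≡ true → 1 ≤ size F
  size-≥1 {F} u v p = count-≥1 _ (combine u v)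
    (trans (cong (λ x → F (proj₁ x) (proj₂ x)) (remQuot-combine u v)) p)

  pair : Fin n → Fin n → EdgeSet n
  pair x y u v = ((u == x) ∧ (v == y)) ∨ ((u == y) ∧ (v == x))

  pair-left : ∀ x y → pair x y x y ≡ true
  pair-left x y = ∨-left (∧-intro (==-refl x) (==-refl y))

  pair-right : ∀ x y → pair x y y x ≡ true
  pair-right x y = ∨-right {(y == x) ∧ (x == y)} (∧-intro (==-refl y) (==-refl x))

  pair-elim : ∀ x y u v → pair x y u v ≡ true → (u ≡ x × v ≡ y) ⊎ (u ≡ y × v ≡ x)
  pair-elim x y u v p with ∨-elim {(u == x) ∧ (v == y)} p
  ... | inj₁ q = inj₁ (==-sound (∧-fst q) , ==-sound (∧-snd {u == x} q))
  ... | inj₂ q = inj₂ (==-sound (∧-fst q) , ==-sound (∧-snd {u == y} q))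

  pair-symmetric : ∀ x y → Symmetric (pair x y)
  pair-symmetric x y u v p with pair-elim x y u v p
  ... | inj₁ (refl , refl) = pair-right x y
  ... | inj₂ (refl , refl) = pair-left x y

  record Reachable (R : EdgeSet n) (a : Fin n) : Set where
    field
      set     : Fin n → Bool
      root    : set a ≡ true
      closed  : ∀ u v → set u ≡ true → R u v ≡ true → set v ≡ true
      path    : ∀ z → set z ≡ true → Star (λ u v → R u v ≡ true) a z

  reachable : ∀ R a → Reachable R a
  reachable R a = grow n (_== a) (count-≤n _) (==-refl a) λ { z p → subst (Star _ a) (≡-sym (==-sound p)) ε }
    where
    -- The fuel `b` bounds the number of vertices still outside `X`.
    grow : ∀ b (X : Fin n → Bool) → count (not ∘ X) ≤ b → X a ≡ true
      → (∀ z → X z ≡ true → Star (λ u v → R u v ≡ true) a z) → Reachable R a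
    grow b X le r pth with search₂ (λ u v → (X u ∧ R u v) ∧ not (X v))
    ... | inj₂ none = record
      { set = X ; root = r ; path = pth
      ; closed = λ u v p q → ¬-not λ e → true≢false (∧-intro (∧-intro p q) (not-intro e)) (none u v) }
    ... | inj₁ (u , v , p) with b
    ...   | zero  = ⊥-elim (<⇒≱ (count-≥1 (not ∘ X) v (∧-snd {X u ∧ R u v} p)) le)
    ...   | suc b = grow b (λ z → X z ∨ (z == v))
                      (s≤s⁻¹ (≤-trans (count-mono-< (λ z q → not-intro (new z q)) v
                                 (cong not (∨-right {X v} (==-refl v))) (∧-snd {X u ∧ R u v} p)) le))
                      (∨-left r) pth'
      where
      new : ∀ z → not (X z ∨ (z == v)) ≡ true → X z ≡ false
      new z q = false-intro λ t → true≢false (∨-left {b = z == v} t) (not-elim q)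
      pth' : ∀ z → X z ∨ (z == v) ≡ true → Star (λ u v → R u v ≡ true) a z
      pth' z q with ∨-elim {X z} q
      ... | inj₁ t = pth z t
      ... | inj₂ t rewrite ==-sound t =
        pth u (∧-fst (∧-fst p)) ◅◅ (∧-snd {X u} (∧-fst p) ◅ ε)

record EdgeColouring {n : ℕ} (F : EdgeSet n) (q : ℕ) : Set where
  field
    colour    : Fin n → Fin n → Fin q
    symmetric : ∀ u v → F u v ≡ true → colour u v ≡ colour v u
    proper    : ∀ u v w → F u v ≡ true → F u w ≡ true → colour u v ≡ colour u w → v ≡ w

  present : Fin n → Fin q → Bool
  present z c = ⌊search⌋ (search λ w → F z w ∧ (colour z w == c))
    where
    ⌊search⌋ : ∀ {A B : Set} → A ⊎ B → Bool
    ⌊search⌋ (inj₁ _) = true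
    ⌊search⌋ (inj₂ _) = false

  present-intro : ∀ z w → F z w ≡ true → present z (colour z w) ≡ true
  present-intro z w p with search (λ x → F z x ∧ (colour z x == colour z w))
  ... | inj₁ _ = refl
  ... | inj₂ none = true≢false (∧-intro p (==-refl (colour z w))) (none w)

  present-elim : ∀ z c → present z c ≡ true → ∃ λ w → F z w ≡ true × colour z w ≡ c
  present-elim z c p with search (λ x → F z x ∧ (colour z x == c))
  ... | inj₁ (w , r) = w , ∧-fst r , ==-sound (∧-snd {F z w} r)
  ... | inj₂ _ = true≢false p refl

  degree≤present : ∀ z → count (F z) ≤ count (present z)
  degree≤present z = count-injective (F z) (present z) (λ w _ → colour z w)
    (present-intro z) (λ v w p r → proper z v w p r)

  present≤degree : ∀ z → count (present z) ≤ count (F z)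
  present≤degree z = count-injective (present z) (F z) (λ c p → proj₁ (present-elim z c p))
    (λ c p → proj₁ (proj₂ (present-elim z c p)))
    (λ c d p r e → trans (≡-sym (proj₂ (proj₂ (present-elim z c p))))
                     (trans (cong (colour z) e) (proj₂ (proj₂ (present-elim z d r)))))

  missing : ∀ z → count (F z) < q → ∃ λ c → ∀ w → F z w ≡ true → colour z w ≢ c
  missing z lt with count-missing (present z) (≤-<-trans (present≤degree z) lt)
  ... | c , h = c , λ { w p refl → true≢false (present-intro z w p) h }
open EdgeColouring public

-- Membership in A(q), expressed for edge sets; in this form it passes to subsets at once.
EdgeColourable : ∀ {n} → ℕ → EdgeSet n → Set
EdgeColourable q P = ∀ F → Symmetric F → F ⊆ P → (∀ z → count (F z) ≤ q) → EdgeColouring F q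

-- Degrees after deletion, and matchings that meet all vertices of large degree

degree-∖-≥ : ∀ {n} (F N : EdgeSet n) → Matching N → ∀ z → count (F z) ≤ suc (count ((F ∖ N) z))
degree-∖-≥ F N mN z rewrite degree-split F N z =
  +-mono-≤ (count-≤1 ((F ∩ N) z) λ v w p r → mN z v w (∧-snd {F z v} p) (∧-snd {F z w} r)) ≤-refl

degree-∖-< : ∀ {n} (F N : EdgeSet n) z w → F z w ≡ true → N z w ≡ true → count ((F ∖ N) z) < count (F z)
degree-∖-< F N z w p r = count-mono-< (λ v → ∧-fst) w
  (trans (cong (λ b → F z w ∧ not b) r) (∧-zeroʳ (F z w))) p

degree-mono : ∀ {n} (F H : EdgeSet n) → F ⊆ H → ∀ z → count (F z) ≤ count (H z)
degree-mono F H F⊆H z = count-mono (F⊆H z)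

degree-∖-≤ : ∀ {n} (F N : EdgeSet n) z → count ((F ∖ N) z) ≤ count (F z)
degree-∖-≤ F N z = count-mono {P = (F ∖ N) z} λ _ → ∧-fst

pair-matching : ∀ {n} (x y : Fin n) → Matching (pair x y)
pair-matching x y u v w p r with pair-elim x y u v p | pair-elim x y u w r
... | inj₁ (_ , refl)    | inj₁ (_ , refl)    = refl
... | inj₂ (_ , refl)    | inj₂ (_ , refl)    = refl
... | inj₁ (refl , refl) | inj₂ (refl , refl) = refl
... | inj₂ (refl , refl) | inj₁ (refl , refl) = refl

module _ {n q : ℕ} where

  unforbidden-missing : ∀ {L : EdgeSet n} → EdgeColouring L q → (Fin q → Bool) → Fin n → Fin q → Bool
  unforbidden-missing χ B z c = not (B c) ∧ not (present χ z c)

  -- A substitute for a q-edge-colouring of `L` when some degrees exceed q. The bound in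
  -- `few-missing` is the number of colours that a genuine q-edge-colouring of `L` would leave out
  -- at `z`; by truncated subtraction it is 0 from degree q on, so every allowed colour occurs at
  -- such a vertex.
  record NearColouring (L : EdgeSet n) (k : ℕ) : Set where
    field
      part           : EdgeSet n
      part-symmetric : Symmetric part
      part-⊆         : part ⊆ L
      colouring      : EdgeColouring part q
      forbidden      : Fin q → Bool
      forbidden-≤    : count forbidden ≤ k
      few-missing    : ∀ z → count (unforbidden-missing colouring forbidden z) ≤ q ∸ count (L z)

  -- Deleting an edge at an overfull vertex d costs only its other end p one
  -- colour, and that colour is then forbidden.
  restore-edge : ∀ {k} L d p → q < count (L d)
    → NearColouring (L ∖ pair d p) k → NearColouring L (suc k)
  restore-edge {k} L d p overfull rest = result
    where
    open NearColouring rest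
    ∸-step : ∀ {a b} → a ≤ suc b → q ∸ b ≤ suc (q ∸ a)
    ∸-step {a} {b} le = ≤-trans (ℕₚ.∸-monoʳ-≤ (suc q) le) (suc-∸ a)
      where
      suc-∸ : ∀ a → suc q ∸ a ≤ suc (q ∸ a)
      suc-∸ a = ℕₚ.m≤n+o⇒m∸n≤o (suc q) a (≤-trans (s≤s (ℕₚ.m≤n+m∸n q a)) (≤-reflexive (≡-sym (+-suc a _))))
    elsewhere : ∀ B → (∀ c → B c ≡ false → forbidden c ≡ false) → ∀ z → z ≢ p
      → count (unforbidden-missing colouring B z) ≤ q ∸ count (L z)
    elsewhere B weaker z z≢p with z Fin.≟ d
    -- The degree of `d` is still at least q after the deletion, so no allowed colour is missing
    -- there.
    ... | yes refl = ≤-trans (count-mono λ c m → ∧-intro (not-intro (weaker c (not-elim (∧-fst m)))) (∧-snd {not (B c)} m))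
                       (≤-trans (few-missing z) (≤-trans (≤-reflexive (ℕₚ.m≤n⇒m∸n≡0
                         (s≤s⁻¹ (≤-trans overfull (degree-∖-≥ L (pair d p) (pair-matching d p) d))))) z≤n))
    ... | no z≢d = ≤-trans (count-mono λ c m → ∧-intro (not-intro (weaker c (not-elim (∧-fst m)))) (∧-snd {not (B c)} m))
                       (≤-trans (few-missing z) (ℕₚ.∸-monoʳ-≤ q (count-mono λ w Lzw → ∧-intro Lzw
                         (not-intro (false-intro λ r → [ z≢d ∘ proj₁ , z≢p ∘ proj₁ ]′ (pair-elim d p z w r))))))
    result : NearColouring L (suc k)
    result with count (unforbidden-missing colouring forbidden p) ℕₚ.≤? q ∸ count (L p)
    ... | yes le = record
      { part = part ; part-symmetric = part-symmetric ; part-⊆ = λ u v → ∧-fst ∘ part-⊆ u v ; colouring = colouring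
      ; forbidden = forbidden ; forbidden-≤ = ℕₚ.m≤n⇒m≤1+n forbidden-≤
      ; few-missing = few }
      where
      few : ∀ z → count (unforbidden-missing colouring forbidden z) ≤ q ∸ count (L z)
      few z with z Fin.≟ p
      ... | yes refl = le
      ... | no z≢p = elsewhere forbidden (λ _ e → e) z z≢p
    -- The degree of `p` drops by at most one, so the bound at `p` is exceeded by at most one;
    -- forbidding any one of the colours missing at `p` repairs it.
    ... | no nle' with count-witness (unforbidden-missing colouring forbidden p) (≤-trans (s≤s z≤n) (≰⇒> nle'))
    ...   | c₀ , m₀ = record
      { part = part ; part-symmetric = part-symmetric ; part-⊆ = λ u v → ∧-fst ∘ part-⊆ u v ; colouring = colouring
      ; forbidden = B ; forbidden-≤ = B-≤
      ; few-missing = few }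
      where
      B : Fin q → Bool
      B c = forbidden c ∨ (c == c₀)
      B-weaker : ∀ c → B c ≡ false → forbidden c ≡ false
      B-weaker c e = false-intro λ t → true≢false (∨-left {b = c == c₀} t) e
      B-≤ : count B ≤ suc k
      B-≤ rewrite count-remove B c₀ (∨-right {forbidden c₀} (==-refl c₀)) =
        s≤s (≤-trans (count-mono λ c t → [ (λ f → f) , (λ e → true≢false e (not-elim (∧-snd {B c} t))) ]′
                                            (∨-elim {forbidden c} (∧-fst t)))
                     forbidden-≤)
      at-p : count (unforbidden-missing colouring B p) ≤ q ∸ count (L p)
      at-p = s≤s⁻¹ (≤-trans
        (count-mono-< (λ c m → ∧-intro (not-intro (B-weaker c (not-elim (∧-fst m)))) (∧-snd {not (B c)} m)) c₀
          (cong (λ b → not b ∧ not (present colouring p c₀)) (∨-right {forbidden c₀} (==-refl c₀))) m₀)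
        (≤-trans (few-missing p) (∸-step (degree-∖-≥ L (pair d p) (pair-matching d p) p))))
      few : ∀ z → count (unforbidden-missing colouring B z) ≤ q ∸ count (L z)
      few z with z Fin.≟ p
      ... | yes refl = at-p
      ... | no z≢p = elsewhere B B-weaker z z≢p

  near-colouring : ∀ {E : EdgeSet n} → EdgeColourable q E → ∀ ds L → Symmetric L → L ⊆ E
    → (∀ z → count (L z) ≤ q ⊎ (z ∈ ds × count (L z) ≤ suc q)) → NearColouring L (length ds)
  near-colouring aE [] L sL L⊆E h = record
    { part = L ; part-symmetric = sL ; part-⊆ = λ _ _ p → p ; colouring = χ
    ; forbidden = const false ; forbidden-≤ = ≤-reflexive (count-none {q} _ λ _ → refl)
    -- Missing and present colours add up to q, and at least as many colours as the degree are
    -- present.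
    ; few-missing = λ z → ℕₚ.m+n≤o⇒m≤o∸n _
        (≤-trans (+-monoʳ-≤ _ (degree≤present χ z))
        (≤-trans (≤-reflexive (+-comm _ (count (present χ z))))
        (≤-trans (≤-reflexive (≡-sym (count-split (const true) (present χ z)))) (count-≤n {q} (const true))))) }
    where
    χ = aE L sL L⊆E λ z → [ (λ le → le) , (λ { (() , _) }) ]′ (h z)
  near-colouring {E} aE (d ∷ ds) L sL L⊆E h with count (L d) ℕₚ.≤? q
  ... | yes le = record { NearColouring rest ; forbidden-≤ = ℕₚ.m≤n⇒m≤1+n (NearColouring.forbidden-≤ rest) }
    where
    rest = near-colouring aE ds L sL L⊆E
      λ z → [ inj₁ , (λ { (here refl , _) → inj₁ le ; (there m , b) → inj₂ (m , b) }) ]′ (h z)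
  -- Any edge at `d` will do: `d` has degree exactly q + 1, so the deletion brings it down to q.
  ... | no nle with count-witness (L d) (≤-trans (s≤s z≤n) (≰⇒> nle))
  ...   | p , Ldp = restore-edge L d p (≰⇒> nle)
    (near-colouring aE ds (L ∖ pair d p) (∖-symmetric sL (pair-symmetric d p)) (λ u v → L⊆E u v ∘ ∧-fst) λ z →
      [ (λ le → inj₁ (≤-trans (degree-∖-≤ L (pair d p) z) le))
      , (λ { (here refl , b) → inj₁ (s≤s⁻¹ (≤-trans (degree-∖-< L (pair d p) d p Ldp (pair-left d p)) b))
           ; (there m , b) → inj₂ (m , ≤-trans (degree-∖-≤ L (pair d p) z) b) }) ]′ (h z))

  -- At most `length ds` colours get forbidden, so one of the q colours is allowed, and its class
  -- meets every vertex where `few-missing` is bounded by 0.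
  saturating-matching : ∀ {E : EdgeSet n} → EdgeColourable q E → ∀ ds → length ds < q → ∀ L → Symmetric L → L ⊆ E
    → (∀ z → count (L z) ≤ q ⊎ (z ∈ ds × count (L z) ≤ suc q))
    → ∃ λ C → Symmetric C × Matching C × C ⊆ L × (∀ z → q ≤ count (L z) → Covers C z)
  saturating-matching aE ds short L sL L⊆E h = C , C-symmetric , C-matching , (λ u v → part-⊆ u v ∘ ∧-fst) , C-covers
    where
    open NearColouring (near-colouring aE ds L sL L⊆E h)
    allowed : ∃ λ c → forbidden c ≡ false
    allowed = count-missing forbidden (≤-<-trans forbidden-≤ short)
    c = proj₁ allowed
    C : EdgeSet n
    C u v = part u v ∧ (colour colouring u v == c)
    C-symmetric : Symmetric C
    C-symmetric u v p = ∧-intro (part-symmetric u v (∧-fst p))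
      (==-complete (trans (≡-sym (symmetric colouring u v (∧-fst p))) (==-sound (∧-snd {part u v} p))))
    C-matching : Matching C
    C-matching u v w p r = proper colouring u v w (∧-fst p) (∧-fst r)
      (trans (==-sound (∧-snd {part u v} p)) (≡-sym (==-sound (∧-snd {part u w} r))))
    C-covers : ∀ z → q ≤ count (L z) → Covers C z
    C-covers z full with true⊎false (present colouring z c)
    ... | inj₁ p = let w , r , e = present-elim colouring z c p in w , ∧-intro r (==-complete e)
    ... | inj₂ p = ⊥-elim (<⇒≱ (count-≥1 (unforbidden-missing colouring forbidden z) c
                     (∧-intro (not-intro (proj₂ allowed)) (not-intro p)))
                   (≤-trans (few-missing z) (≤-reflexive (ℕₚ.m≤n⇒m∸n≡0 full))))

-- Lumped colourings

ZeroOr : ℕ → ℕ → Set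
ZeroOr k x = x ≡ 0 ⊎ x ≡ k

module _ {n : ℕ} (q : ℕ) where

  class : EdgeSet n → (Fin n → Fin n → ℕ) → ℕ → EdgeSet n
  class E j k u v = E u v ∧ ⌊ j u v ℕₚ.≟ k ⌋

  class-intro : ∀ E j k u v → E u v ≡ true → j u v ≡ k → class E j k u v ≡ true
  class-intro E j k u v p e = ∧-intro p (dec-complete (j u v ℕₚ.≟ k) e)

  class-edge : ∀ E j k u v → class E j k u v ≡ true → E u v ≡ true
  class-edge E j k u v = ∧-fst

  class-value : ∀ E j k u v → class E j k u v ≡ true → j u v ≡ k
  class-value E j k u v p = dec-sound (j u v ℕₚ.≟ k) (∧-snd {E u v} p)

  -- Colour 0 stands for q of the original colours lumped together, so its
  -- class is only required to have maximum degree at most q.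
  record Lumped (E : EdgeSet n) (m : ℕ) (j : Fin n → Fin n → ℕ) : Set where
    field
      j-symmetric : ∀ u v → E u v ≡ true → j u v ≡ j v u
      j-bounded   : ∀ u v → E u v ≡ true → j u v ≤ m
      j-proper    : ∀ u v w → E u v ≡ true → E u w ≡ true → j u v ≡ j u w → j u v ≢ 0 → v ≡ w
      j-small     : ∀ z → count (class E j 0 z) ≤ q

  -- The value `k` = 0 is permitted, so maps that agree on all edges are also one move apart.
  Move : EdgeSet n → (j j' : Fin n → Fin n → ℕ) → Set
  Move E j j' = ∃ λ k → ∀ u v → E u v ≡ true → j u v ≡ j' u v ⊎ (ZeroOr k (j u v) × ZeroOr k (j' u v))

  data Moves (E : EdgeSet n) (m : ℕ) : (j g : Fin n → Fin n → ℕ) → Set where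
    done : ∀ {j g} → (∀ u v → E u v ≡ true → j u v ≡ g u v) → Moves E m j g
    step : ∀ {j j' g} → Move E j j' → Lumped E m j' → Moves E m j' g → Moves E m j g

  Moves-trans : ∀ {E m j h g} → Lumped E m h → Moves E m j h → Moves E m h g → Moves E m j g
  -- The two maps agree on edges only, so they are joined by a neutral move rather than identified.
  Moves-trans J (done e) s = step (0 , λ u v p → inj₁ (e u v p)) J s
  Moves-trans J (step mv J' r) s = step mv J' (Moves-trans J r s)

  module _ {E : EdgeSet n} (sE : Symmetric E) {m : ℕ} {j : Fin n → Fin n → ℕ} (J : Lumped E m j) where
    open Lumped J

    class-symmetric : ∀ k → Symmetric (class E j k)
    class-symmetric k u v p = class-intro E j k v u (sE u v e) (trans (≡-sym (j-symmetric u v e)) (class-value E j k u v p))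
      where e = class-edge E j k u v p

    class-matching : ∀ k → 1 ≤ k → Matching (class E j k)
    class-matching k 1≤k u v w p r = j-proper u v w (class-edge E j k u v p) (class-edge E j k u w r)
      (trans (class-value E j k u v p) (≡-sym (class-value E j k u w r)))
      λ e → <⇒≱ 1≤k (≤-reflexive (trans (≡-sym (class-value E j k u v p)) e))

  zero-and : EdgeSet n → (Fin n → Fin n → ℕ) → ℕ → EdgeSet n
  zero-and E j k = class E j 0 ∪ class E j k

  zero-and-intro : ∀ E j k u v → E u v ≡ true → ZeroOr k (j u v) → zero-and E j k u v ≡ true
  zero-and-intro E j k u v e (inj₁ r) = ∨-left (class-intro E j 0 u v e r)
  zero-and-intro E j k u v e (inj₂ r) = ∨-right {class E j 0 u v} (class-intro E j k u v e r)

  zero-and-edge : ∀ E j k u v → zero-and E j k u v ≡ true → E u v ≡ true × ZeroOr k (j u v)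
  zero-and-edge E j k u v p with ∨-elim {class E j 0 u v} p
  ... | inj₁ r = class-edge E j 0 u v r , inj₁ (class-value E j 0 u v r)
  ... | inj₂ r = class-edge E j k u v r , inj₂ (class-value E j k u v r)

  zero-and-degree : ∀ {E} (sE : Symmetric E) {m j} → Lumped E m j → ∀ k → 1 ≤ k
    → ∀ z → count (zero-and E j k z) ≤ suc (count (class E j 0 z))
  zero-and-degree {E} sE {j = j} J k 1≤k z =
    ≤-trans (degree-∖-≥ (zero-and E j k) (class E j k) (class-matching sE J k 1≤k) z)
      (s≤s (count-mono {P = (zero-and E j k ∖ class E j k) z} λ v p →
        [ (λ r → r) , (λ r → true≢false r (not-elim (∧-snd {zero-and E j k z v} p))) ]′
        (∨-elim {class E j 0 z v} (∧-fst p))))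

  recolour : EdgeSet n → (Fin n → Fin n → ℕ) → ℕ → EdgeSet n → Fin n → Fin n → ℕ
  recolour E j k C u v = if zero-and E j k u v then (if C u v then k else 0) else j u v

  -- Redistributes the edges of colours 0 and `k`: `C` becomes the new class `k` and the others get
  -- colour 0. That `C` is a matching keeps class `k` proper, and `small` keeps colour 0 within
  -- degree q.
  module Recolour {E : EdgeSet n} (sE : Symmetric E) {m : ℕ} {j : Fin n → Fin n → ℕ} (J : Lumped E m j)
    (k : ℕ) (1≤k : 1 ≤ k) (k≤m : k ≤ m)
    (C : EdgeSet n) (sC : Symmetric C) (mC : Matching C) (C⊆K : C ⊆ zero-and E j k)
    (small : ∀ z → count ((zero-and E j k ∖ C) z) ≤ q) where
    open Lumped J

    K : EdgeSet n
    K = zero-and E j k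

    j' : Fin n → Fin n → ℕ
    j' = recolour E j k C

    k≢0 : k ≢ 0
    k≢0 e = <⇒≱ 1≤k (≤-reflexive e)

    data View (u v : Fin n) : Set where
      in-C  : C u v ≡ true → j' u v ≡ k → View u v
      in-K  : K u v ≡ true → C u v ≡ false → j' u v ≡ 0 → View u v
      other : K u v ≡ false → ¬ ZeroOr k (j u v) → j' u v ≡ j u v → View u v

    view : ∀ u v → E u v ≡ true → View u v
    view u v e with true⊎false (K u v) | true⊎false (C u v)
    ... | inj₁ p | inj₁ r = in-C r (trans (cong (λ b → if b then (if C u v then k else 0) else j u v) p) (cong (λ b → if b then k else 0) r))
    ... | inj₁ p | inj₂ r = in-K p r (trans (cong (λ b → if b then (if C u v then k else 0) else j u v) p) (cong (λ b → if b then k else 0) r))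
    ... | inj₂ p | _ = other p (λ z → true≢false (zero-and-intro E j k u v e z) p)
                         (cong (λ b → if b then (if C u v then k else 0) else j u v) p)

    sK : Symmetric K
    sK = ∪-symmetric (class-symmetric sE J 0) (class-symmetric sE J k)

    zero-class-⊆ : class E j' 0 ⊆ (K ∖ C)
    zero-class-⊆ u v p with view u v (class-edge E j' 0 u v p)
    ... | in-C _ e = ⊥-elim (k≢0 (trans (≡-sym e) (class-value E j' 0 u v p)))
    ... | in-K r s _ = ∧-intro r (not-intro s)
    ... | other _ nz e = ⊥-elim (nz (inj₁ (trans (≡-sym e) (class-value E j' 0 u v p))))

    zero-class-⊇ : (K ∖ C) ⊆ class E j' 0
    zero-class-⊇ u v p with view u v (proj₁ (zero-and-edge E j k u v (∧-fst p)))
    ... | in-C r _ = true≢false r (not-elim (∧-snd {K u v} p))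
    ... | in-K _ _ e = class-intro E j' 0 u v (proj₁ (zero-and-edge E j k u v (∧-fst p))) e
    ... | other r _ _ = true≢false (∧-fst p) r

    k-class-⊆ : class E j' k ⊆ C
    k-class-⊆ u v p with view u v (class-edge E j' k u v p)
    ... | in-C r _ = r
    ... | in-K _ _ e = ⊥-elim (k≢0 (trans (≡-sym (class-value E j' k u v p)) e))
    ... | other _ nz e = ⊥-elim (nz (inj₂ (trans (≡-sym e) (class-value E j' k u v p))))

    k-class-⊇ : C ⊆ class E j' k
    k-class-⊇ u v p with view u v (proj₁ (zero-and-edge E j k u v (C⊆K u v p)))
    ... | in-C _ e = class-intro E j' k u v (proj₁ (zero-and-edge E j k u v (C⊆K u v p))) e
    ... | in-K _ r _ = true≢false p r
    ... | other r _ _ = true≢false (C⊆K u v p) r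

    move : Move E j j'
    move = k , λ u v e → moved u v e (view u v e)
      where
      moved : ∀ u v → E u v ≡ true → View u v → j u v ≡ j' u v ⊎ (ZeroOr k (j u v) × ZeroOr k (j' u v))
      moved u v e (in-C r s) = inj₂ (proj₂ (zero-and-edge E j k u v (C⊆K u v r)) , inj₂ s)
      moved u v e (in-K r _ s) = inj₂ (proj₂ (zero-and-edge E j k u v r) , inj₁ s)
      moved u v e (other _ _ s) = inj₁ (≡-sym s)

    lumped : Lumped E m j'
    lumped = record
      { j-symmetric = symm ; j-bounded = bounded ; j-proper = prop
      ; j-small = λ z → ≤-trans (count-mono (zero-class-⊆ z)) (small z) }
      where
      symm : ∀ u v → E u v ≡ true → j' u v ≡ j' v u
      symm u v e with view u v e | view v u (sE u v e)
      ... | in-C _ a | in-C _ b = trans a (≡-sym b)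
      ... | in-C r _ | in-K _ s _ = true≢false (sC u v r) s
      ... | in-C r _ | other s _ _ = true≢false (sK u v (C⊆K u v r)) s
      ... | in-K _ r _ | in-C s _ = true≢false (sC v u s) r
      ... | in-K _ _ a | in-K _ _ b = trans a (≡-sym b)
      ... | in-K r _ _ | other s _ _ = true≢false (sK u v r) s
      ... | other r _ _ | in-C s _ = true≢false (sK v u (C⊆K v u s)) r
      ... | other r _ _ | in-K s _ _ = true≢false (sK v u s) r
      ... | other _ _ a | other _ _ b = trans a (trans (j-symmetric u v e) (≡-sym b))
      bounded : ∀ u v → E u v ≡ true → j' u v ≤ m
      bounded u v e with view u v e
      ... | in-C _ a = subst (_≤ m) (≡-sym a) k≤m
      ... | in-K _ _ a = subst (_≤ m) (≡-sym a) z≤n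
      ... | other _ _ a = subst (_≤ m) (≡-sym a) (j-bounded u v e)
      prop : ∀ u v w → E u v ≡ true → E u w ≡ true → j' u v ≡ j' u w → j' u v ≢ 0 → v ≡ w
      prop u v w p r e ne with view u v p | view u w r
      ... | in-K _ _ a | _ = ⊥-elim (ne a)
      ... | in-C _ _ | in-K _ _ b = ⊥-elim (ne (trans e b))
      ... | other _ _ _ | in-K _ _ b = ⊥-elim (ne (trans e b))
      ... | in-C a _ | in-C b _ = mC u v w a b
      ... | in-C _ a | other _ nz b = ⊥-elim (nz (inj₂ (trans (≡-sym b) (trans (≡-sym e) a))))
      ... | other _ nz a | in-C _ b = ⊥-elim (nz (inj₂ (trans (≡-sym a) (trans e b))))
      ... | other _ _ a | other _ _ b = j-proper u v w p r (trans (≡-sym a) (trans e b)) λ z → ne (trans a z)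

  -- N is the matching being turned into a prescribed one along alternating
  -- paths; D lists the ends of the paths that are still open.
  record State (E : EdgeSet n) (m : ℕ) (j : Fin n → Fin n → ℕ) (N : EdgeSet n) (D : List (Fin n)) : Set where
    field
      lumped      : Lumped E m j
      N-symmetric : Symmetric N
      N-matching  : Matching N
      N-⊆         : N ⊆ class E j 0
      D-short     : length D ≤ 2
      N-saturates : ∀ z → Covers N z ⊎ (z ∈ D ⊎ count (class E j 0 z) < q)

  module _ (3≤q : 3 ≤ q) {E : EdgeSet n} (sE : Symmetric E) (aE : EdgeColourable q E) {m : ℕ} where

    advance : ∀ {j} → Lumped E m j → ∀ k → 1 ≤ k → k ≤ m
      → ∀ N D → Symmetric N → Matching N → N ⊆ zero-and E j k → length D ≤ 2
      → (∀ z → Covers N z ⊎ (z ∈ D ⊎ count (zero-and E j k z) ≤ q))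
      → ∃ λ j' → Move E j j' × State E m j' N D
    advance {j} J k 1≤k k≤m N D sN mN N⊆K short sat =
      R.j' , R.move , record
        { lumped = R.lumped ; N-symmetric = sN ; N-matching = mN ; D-short = short
        ; N-⊆ = λ u v p → R.zero-class-⊇ u v (∧-intro (N⊆K u v p) (not-intro (false-intro λ c → true≢false p (not-elim (∧-snd {K u v} (C⊆L u v c))))))
        ; N-saturates = λ z → Sum.map₂ (Sum.map₂ (fewer z)) (undecided z) }
      where
      K L : EdgeSet n
      K = zero-and E j k
      L = K ∖ N
      sK : Symmetric K
      sK = ∪-symmetric (class-symmetric sE J 0) (class-symmetric sE J k)
      K-degree : ∀ z → count (K z) ≤ suc q
      K-degree z = ≤-trans (zero-and-degree sE J k 1≤k z) (s≤s (Lumped.j-small J z))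
      L-degree : ∀ z → count (L z) ≤ q ⊎ (z ∈ D × count (L z) ≤ suc q)
      L-degree z with sat z
      ... | inj₁ (w , p) = inj₁ (s≤s⁻¹ (≤-trans (degree-∖-< K N z w (N⊆K z w p) p) (K-degree z)))
      ... | inj₂ (inj₁ d) = inj₂ (d , ≤-trans (degree-∖-≤ K N z) (K-degree z))
      ... | inj₂ (inj₂ le) = inj₁ (≤-trans (degree-∖-≤ K N z) le)
      saturating = saturating-matching aE D (≤-trans (s≤s short) 3≤q) L
        (∖-symmetric sK sN) (λ u v p → proj₁ (zero-and-edge E j k u v (∧-fst p))) L-degree
      C = proj₁ saturating
      sC = proj₁ (proj₂ saturating)
      mC = proj₁ (proj₂ (proj₂ saturating))
      C⊆L = proj₁ (proj₂ (proj₂ (proj₂ saturating)))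
      C-covers = proj₂ (proj₂ (proj₂ (proj₂ saturating)))
      C⊆K : C ⊆ K
      C⊆K u v p = ∧-fst (C⊆L u v p)
      small : ∀ z → count ((K ∖ C) z) ≤ q
      -- Either `C` removes an edge at `z`, or `L` has fewer than q edges there and the matching `N`
      -- adds at most one.
      small z with q ℕₚ.≤? count (L z)
      ... | yes full = let w , c = C-covers z full in
        s≤s⁻¹ (≤-trans (degree-∖-< K C z w (C⊆K z w c) c) (K-degree z))
      ... | no slack = ≤-trans (degree-∖-≤ K C z) (≤-trans (degree-∖-≥ K N mN z) (≰⇒> slack))
      module R = Recolour sE J k 1≤k k≤m C sC mC C⊆K small
      undecided : ∀ z → Covers N z ⊎ (z ∈ D ⊎ (count (K z) ≤ q × ∀ w → N z w ≡ false))
      undecided z with covers? N z | sat z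
      ... | inj₁ c | _ = inj₁ c
      ... | inj₂ _ | inj₁ c = inj₁ c
      ... | inj₂ _ | inj₂ (inj₁ d) = inj₂ (inj₁ d)
      ... | inj₂ none | inj₂ (inj₂ le) = inj₂ (inj₂ (le , none))
      fewer : ∀ z → count (K z) ≤ q × (∀ w → N z w ≡ false) → count (class E R.j' 0 z) < q
      -- As `N` misses `z`, all of its at most q edges in `K` belong to `L`: either there are fewer
      -- than q of them, or `C` takes one.
      fewer z (le , none) = [ covered , (λ slack → ≤-<-trans zero-degree
          (≤-<-trans (degree-∖-≤ K C z) (≤-<-trans K≤L slack))) ]′ (Sum.swap (ℕₚ.<-≤-connex (count (L z)) q))
        where
        zero-degree : count (class E R.j' 0 z) ≤ count ((K ∖ C) z)
        zero-degree = degree-mono (class E R.j' 0) (K ∖ C) R.zero-class-⊆ z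
        K≤L : count (K z) ≤ count (L z)
        K≤L = count-mono {P = K z} {Q = L z} λ w p → ∧-intro p (not-intro (none w))
        covered : q ≤ count (L z) → count (class E R.j' 0 z) < q
        covered full = let w , c = C-covers z full in
          ≤-<-trans zero-degree (≤-trans (degree-∖-< K C z w (C⊆K z w c) c) le)

-- Rerouting a matching towards a prescribed one

xor-true : ∀ a b → a xor b ≡ true → a ≢ b
xor-true true  false _ ()
xor-true false true  _ ()

≢⇒xor : ∀ {a b} → a ≢ b → a xor b ≡ true
≢⇒xor {true}  {true}  ne = ⊥-elim (ne refl)
≢⇒xor {true}  {false} ne = refl
≢⇒xor {false} {true}  ne = refl
≢⇒xor {false} {false} ne = ⊥-elim (ne refl)

≡⇒xor : ∀ {a b} → a ≡ b → a xor b ≡ false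
≡⇒xor {true}  refl = refl
≡⇒xor {false} refl = refl

xor-false : ∀ a b → a xor b ≡ false → a ≡ b
xor-false true  true  _ = refl
xor-false false false _ = refl

_△_ : ∀ {n} → EdgeSet n → EdgeSet n → EdgeSet n
(F △ H) u v = F u v xor H u v

module _ {n : ℕ} where

  partners : EdgeSet n → Fin n → List (Fin n)
  partners N z = [ (λ { (y , _) → y ∷ [] }) , (λ _ → []) ]′ (covers? N z)

  partners-∈ : ∀ {N} → Matching N → ∀ z u → N z u ≡ true → u ∈ partners N z
  partners-∈ {N} mN z u p with covers? N z
  ... | inj₁ (y , r) = here (mN z u y p r)
  ... | inj₂ none = true≢false p (none u)

  partners-length : ∀ N z → length (partners N z) ≤ 1
  partners-length N z with covers? N z
  ... | inj₁ _ = ≤-refl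
  ... | inj₂ _ = z≤n

  -- Two situations share this form: `z x` is an edge of `M`, or `z` = `x` is missed by `M`. In
  -- both, `M` does not lead out of the set of `z` and `x`, so using `M` at these vertices and `N`
  -- elsewhere gives a matching again.
  module Patch {M N : EdgeSet n} (sM : Symmetric M) (mM : Matching M) (sN : Symmetric N) (mN : Matching N)
    (z x : Fin n) (z-only : ∀ v → M z v ≡ true → v ≡ x) (x-only : ∀ v → M x v ≡ true → v ≡ z) where

    touched : Fin n → Bool
    touched u = (u == z) ∨ (u == x)

    patch : EdgeSet n
    patch u v = if touched u ∨ touched v then M u v else N u v

    touched-elim : ∀ u → touched u ≡ true → u ≡ z ⊎ u ≡ x
    touched-elim u t = Sum.map ==-sound ==-sound (∨-elim {u == z} t)

    touched-z : touched z ≡ true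
    touched-z = ∨-left (==-refl z)

    touched-x : touched x ≡ true
    touched-x = ∨-right {x == z} (==-refl x)

    M-touched : ∀ u v → M u v ≡ true → touched u ≡ true → touched v ≡ true
    M-touched u v p t with touched-elim u t
    ... | inj₁ refl = subst (λ y → touched y ≡ true) (≡-sym (z-only v p)) touched-x
    ... | inj₂ refl = subst (λ y → touched y ≡ true) (≡-sym (x-only v p)) touched-z

    patch-inside : ∀ u v → touched u ∨ touched v ≡ true → patch u v ≡ M u v
    patch-inside u v t = cong (λ b → if b then M u v else N u v) t

    patch-outside : ∀ u v → touched u ∨ touched v ≡ false → patch u v ≡ N u v
    patch-outside u v t = cong (λ b → if b then M u v else N u v) t

    patch-elim : ∀ u v → patch u v ≡ true
      → (M u v ≡ true × touched u ≡ true) ⊎ (N u v ≡ true × touched u ∨ touched v ≡ false)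
    patch-elim u v p with true⊎false (touched u ∨ touched v)
    ... | inj₂ t = inj₂ (trans (≡-sym (patch-outside u v t)) p , t)
    ... | inj₁ t = inj₁ (Muv , [ (λ r → r) , M-touched v u (sM u v Muv) ]′ (∨-elim {touched u} t))
      where
      Muv : M u v ≡ true
      Muv = trans (≡-sym (patch-inside u v t)) p

    outside-sym : ∀ u v → touched u ∨ touched v ≡ false → touched v ∨ touched u ≡ false
    outside-sym u v t = false-intro λ s → true≢false
      ([ ∨-right {touched u} , ∨-left ]′ (∨-elim {touched v} s)) t

    patch-symmetric : Symmetric patch
    patch-symmetric u v p with patch-elim u v p
    ... | inj₁ (r , t) = trans (patch-inside v u (∨-right {touched v} t)) (sM u v r)
    ... | inj₂ (r , t) = trans (patch-outside v u (outside-sym u v t)) (sN u v r)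

    patch-matching : Matching patch
    patch-matching u v w p r with patch-elim u v p | patch-elim u w r
    ... | inj₁ (a , _) | inj₁ (b , _) = mM u v w a b
    ... | inj₂ (a , _) | inj₂ (b , _) = mN u v w a b
    ... | inj₁ (_ , t) | inj₂ (_ , s) = true≢false (∨-left {b = touched w} t) s
    ... | inj₂ (_ , s) | inj₁ (_ , t) = true≢false (∨-left {b = touched v} t) s

    patch-⊆ : ∀ {K} → Symmetric K → N ⊆ K → (M z x ≡ true → K z x ≡ true) → patch ⊆ K
    patch-⊆ {K} sK N⊆K new u v p with patch-elim u v p
    ... | inj₂ (r , _) = N⊆K u v r
    ... | inj₁ (r , t) with touched-elim u t
    ...   | inj₁ refl with refl ← z-only v r = new r
    ...   | inj₂ refl with refl ← x-only v r = sK v u (new (sM u v r))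

    patch-covers : ∀ u → Covers N u → Covers patch u ⊎ (touched u ≡ true ⊎ (N z u ≡ true ⊎ N x u ≡ true))
    patch-covers u (v , p) with true⊎false (touched u) | true⊎false (touched v)
    ... | inj₁ t | _ = inj₂ (inj₁ t)
    ... | inj₂ t | inj₂ s = inj₁ (v , trans (patch-outside u v (∨-false t s)) p)
    ... | inj₂ _ | inj₁ s with touched-elim v s
    ...   | inj₁ refl = inj₂ (inj₂ (inj₁ (sN u v p)))
    ...   | inj₂ refl = inj₂ (inj₂ (inj₂ (sN u v p)))

    patch-touched : M z x ≡ true → ∀ u → touched u ≡ true → Covers patch u
    patch-touched p u t with touched-elim u t
    ... | inj₁ refl = x , trans (patch-inside z x (∨-left touched-z)) p
    ... | inj₂ refl = z , trans (patch-inside x z (∨-left touched-x)) (sM z x p)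

    -- The termination measure: all disagreements at `z` and `x` vanish and none arises elsewhere.
    patch-closer : ∀ y → N z y ≢ M z y → size (patch △ M) < size (N △ M)
    patch-closer y ne = size-mono-< closer z y
      (≡⇒xor (patch-inside z y (∨-left touched-z))) (≢⇒xor ne)
      where
      closer : (patch △ M) ⊆ (N △ M)
      closer u v d with true⊎false (touched u ∨ touched v)
      ... | inj₁ t = ⊥-elim (xor-true (patch u v) (M u v) d (patch-inside u v t))
      ... | inj₂ t = ≢⇒xor λ e → xor-true (patch u v) (M u v) d (trans (patch-outside u v t) e)

-- Installing a prescribed matching as a class

module _ {n q : ℕ} (3≤q : 3 ≤ q) {E : EdgeSet n} (sE : Symmetric E) (aE : EdgeColourable q E) {m : ℕ}
  {M : EdgeSet n} (sM : Symmetric M) (mM : Matching M) (M⊆E : M ⊆ E)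
  (M-saturates : ∀ z → (∀ w → M z w ≡ false) → count (E z) ≤ q + m) where

  Installed : (Fin n → Fin n → ℕ) → Set
  Installed j = ∃ λ j' → Moves q E (suc m) j j' × Lumped q E (suc m) j'
    × M ⊆ class q E j' (suc m) × class q E j' (suc m) ⊆ M

  after-move : ∀ {j j'} → Move q E j j' → Lumped q E (suc m) j' → Installed j' → Installed j
  after-move mv J (j'' , r , rest) = j'' , step mv J r , rest

  usable-colour : ∀ {j} → Lumped q E (suc m) j → ∀ u v → E u v ≡ true
    → ∃ λ k → 1 ≤ k × k ≤ suc m × zero-and q E j k u v ≡ true
  usable-colour {j} J u v e = by-value (j u v) refl
    where
    by-value : ∀ c → j u v ≡ c → ∃ λ k → 1 ≤ k × k ≤ suc m × zero-and q E j k u v ≡ true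
    -- An edge of colour 0 is available with every `k`; the top colour is an arbitrary choice.
    by-value zero eq = suc m , s≤s z≤n , ≤-refl , zero-and-intro q E j (suc m) u v e (inj₁ eq)
    by-value (suc k) eq = suc k , s≤s z≤n , subst (_≤ suc m) eq (Lumped.j-bounded J u v e)
                        , zero-and-intro q E j (suc k) u v e (inj₂ eq)

  -- Otherwise `z` would have q edges of colour 0 and one of each of the m + 1 other colours, more
  -- than `M-saturates` admits.
  missing-colour : ∀ {j} → Lumped q E (suc m) j → ∀ z → (∀ w → M z w ≡ false) → q ≤ count (class q E j 0 z)
    → ∃ λ k → 1 ≤ k × k ≤ suc m × (∀ w → class q E j k z w ≡ false)
  missing-colour {j} J z unmatched full with
    finite-choice {n = suc m} {B = ∃ λ k → 1 ≤ k × k ≤ suc m × (∀ w → class q E j k z w ≡ false)}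
      (λ i → Sum.map₂ (λ none → suc (toℕ i) , s≤s z≤n , Finₚ.toℕ<n i , none) (covers? (class q E j (suc (toℕ i))) z))
  ... | inj₂ found = found
  ... | inj₁ all = ⊥-elim (<⇒≱ (s≤s (M-saturates z unmatched))
    (≤-trans (≤-reflexive (≡-sym (+-suc q m)))
    (≤-trans (+-mono-≤ (≤-trans full in-zero) many) (≤-reflexive (≡-sym (degree-split E (class q E j 0) z))))))
    where
    in-zero : count (class q E j 0 z) ≤ count ((E ∩ class q E j 0) z)
    in-zero = degree-mono (class q E j 0) (E ∩ class q E j 0) (λ u v p → ∧-intro (class-edge q E j 0 u v p) p) z
    many : suc m ≤ count ((E ∖ class q E j 0) z)
    many = ≤-trans (count-all {suc m} (const true) λ _ → refl)
      (count-injective (const true) ((E ∖ class q E j 0) z) (λ i _ → proj₁ (all i))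
        (λ i _ → ∧-intro (class-edge q E j (suc (toℕ i)) z _ (proj₂ (all i)))
           (not-intro (false-intro λ t → 0≢suc (trans (≡-sym (class-value q E j 0 z _ t)) (class-value q E j (suc (toℕ i)) z _ (proj₂ (all i)))))))
        (λ i k _ _ e → Finₚ.toℕ-injective (ℕₚ.suc-injective
          (trans (≡-sym (class-value q E j _ z _ (proj₂ (all i)))) (trans (cong (j z) e) (class-value q E j _ z _ (proj₂ (all k))))))))
      where
      0≢suc : ∀ {i} → 0 ≢ suc i
      0≢suc ()

  module _ {j : Fin n → Fin n → ℕ} {N : EdgeSet n} {D : List (Fin n)} (S : State q E (suc m) j N D) where
    open State S

    -- The bookkeeping of open ends. The new list `D'` must contain every vertex whose `N`-edge to
    -- `z` or `x` may be lost, every old open end other than these two, and `z` itself when no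
    -- `M`-edge covers it. The colour `k` is chosen so that an added edge lies in class 0 or class
    -- `k`.
    patched : ∀ z x → (∀ v → M z v ≡ true → v ≡ x) → (∀ v → M x v ≡ true → v ≡ z)
      → (∃ λ k → 1 ≤ k × k ≤ suc m × (M z x ≡ true → zero-and q E j k z x ≡ true))
      → ∀ y → N z y ≢ M z y
      → ∀ D' → length D' ≤ 2
      → (M z x ≡ true ⊎ (z ≡ x × z ∈ D'))
      → (∀ u → N z u ≡ true ⊎ N x u ≡ true → u ∈ D')
      → (∀ u → u ∈ D → (u ≡ z ⊎ u ≡ x) ⊎ u ∈ D')
      → ∃₂ λ j' N' → size (N' △ M) < size (N △ M) × Move q E j j' × State q E (suc m) j' N' D'
    patched z x z-only x-only (k , 1≤k , k≤m , new) y ne D' short matched freed kept =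
      let j' , mv , S' = advance q 3≤q sE aE lumped k 1≤k k≤m patch D' patch-symmetric patch-matching
                           (patch-⊆ sK (λ u v p → ∨-left (N-⊆ u v p)) new) short sat
      in j' , patch , patch-closer y ne , mv , S'
      where
      open Patch sM mM N-symmetric N-matching z x z-only x-only
      sK : Symmetric (zero-and q E j k)
      sK = ∪-symmetric (class-symmetric q sE lumped 0) (class-symmetric q sE lumped k)
      sat-touched : ∀ u → touched u ≡ true → Covers patch u ⊎ u ∈ D'
      sat-touched u t = Sum.map (λ Mzx → patch-touched Mzx u t)
        (λ { (z≡x , d) → subst (_∈ D') (≡-sym ([ (λ e → e) , (λ e → trans e (≡-sym z≡x)) ]′ (touched-elim u t))) d }) matched
      sat : ∀ u → Covers patch u ⊎ (u ∈ D' ⊎ count (zero-and q E j k u) ≤ q)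
      sat u with N-saturates u
      ... | inj₂ (inj₂ lt) = inj₂ (inj₂ (≤-trans (zero-and-degree q sE lumped k 1≤k u) lt))
      ... | inj₂ (inj₁ d) = Sum.map₂ inj₁ ([ sat-touched u ∘ [ (λ { refl → touched-z }) , (λ { refl → touched-x }) ]′ , inj₂ ]′ (kept u d))
      ... | inj₁ c = [ inj₁ , (λ r → Sum.map₂ inj₁ ([ sat-touched u , inj₂ ∘ freed u ]′ r)) ]′ (patch-covers u c)

  -- Without open ends, a vertex missed by `M` has fewer than q edges of colour 0, so joining the
  -- top class to colour 0 gives it at most q; every other vertex loses its edge of `M`.
  finish : ∀ {j N} → State q E (suc m) j N [] → (∀ u v → N u v ≡ M u v) → Installed j
  finish {j} {N} S N≡M = R.j' , step R.move R.lumped (done λ _ _ _ → refl) , R.lumped , R.k-class-⊇ , R.k-class-⊆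
    where
    open State S
    K : EdgeSet n
    K = zero-and q E j (suc m)
    M⊆K : M ⊆ K
    M⊆K u v p = ∨-left (N-⊆ u v (trans (N≡M u v) p))
    small : ∀ z → count ((K ∖ M) z) ≤ q
    small z with N-saturates z
    ... | inj₁ (w , p) = s≤s⁻¹ (≤-trans (degree-∖-< K M z w (M⊆K z w Mzw) Mzw)
                           (≤-trans (zero-and-degree q sE lumped (suc m) (s≤s z≤n) z) (s≤s (Lumped.j-small lumped z))))
      where Mzw = trans (≡-sym (N≡M z w)) p
    ... | inj₂ (inj₂ lt) = ≤-trans (degree-∖-≤ K M z) (≤-trans (zero-and-degree q sE lumped (suc m) (s≤s z≤n) z) lt)
    module R = Recolour q sE lumped (suc m) (s≤s z≤n) ≤-refl M sM mM M⊆K small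

  Progress : (j : Fin n → Fin n → ℕ) (N : EdgeSet n) → Set
  Progress j N = ∃ λ D' → ∃₂ λ j' N' → size (N' △ M) < size (N △ M) × Move q E j j' × State q E (suc m) j' N' D'

  -- The bound 2 on open ends arises here. An `M`-edge `z x` displaces at most one `N`-edge at each
  -- of its ends; if `M` misses `z`, the `N`-edge at `z` is deleted and both of its ends become
  -- open.
  start-patch : ∀ {j N} → State q E (suc m) j N [] → ∀ z y → N z y ≢ M z y → Progress j N
  start-patch {j} {N} S z y ne with covers? M z
  ... | inj₁ (x , Mzx) = _ , patched S z x (λ v p → mM z v x p Mzx) (λ v p → mM x v z p (sM z x Mzx))
        (let k , a , b , c = usable-colour lumped z x (M⊆E z x Mzx) in k , a , b , λ _ → c)
        y ne (partners N z ++ partners N x)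
        (≤-trans (≤-reflexive (length-++ (partners N z))) (+-mono-≤ (partners-length N z) (partners-length N x)))
        (inj₁ Mzx)
        (λ u → [ ∈-++⁺ˡ ∘ partners-∈ N-matching z u , ∈-++⁺ʳ (partners N z) ∘ partners-∈ N-matching x u ]′)
        (λ u ())
    where open State S
  ... | inj₂ none = _ , patched S z z (λ v p → true≢false p (none v)) (λ v p → true≢false p (none v))
        -- No edge is added, so any positive colour serves.
        (suc m , s≤s z≤n , ≤-refl , λ p → true≢false p (none z))
        y ne (z ∷ partners N z) (s≤s (partners-length N z))
        (inj₂ (refl , here refl))
        (λ u → there ∘ partners-∈ N-matching z u ∘ [ (λ p → p) , (λ p → p) ]′)
        (λ u ())
    where open State S

  -- The alternating path is prolonged through `x`: the open end moves from `w` to the `N`-partner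
  -- of `x`, or vanishes if there is none, so the list never grows.
  continue-patch : ∀ {j N w ds} → State q E (suc m) j N (w ∷ ds) → (∀ v → N w v ≡ false) → ∀ x → M w x ≡ true → Progress j N
  continue-patch {j} {N} {w} {ds} S unN x Mwx = _ , patched S w x (λ v p → mM w v x p Mwx) (λ v p → mM x v w p (sM w x Mwx))
        (let k , a , b , c = usable-colour lumped w x (M⊆E w x Mwx) in k , a , b , λ _ → c)
        x (λ e → true≢false Mwx (trans (≡-sym e) (unN x))) (partners N x ++ ds)
        (≤-trans (≤-reflexive (length-++ (partners N x))) (≤-trans (+-mono-≤ (partners-length N x) ≤-refl) D-short))
        (inj₁ Mwx)
        (λ u → [ (λ p → true≢false p (unN u)) , ∈-++⁺ˡ ∘ partners-∈ N-matching x u ]′)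
        (λ { u (here refl) → inj₁ (inj₁ refl) ; u (there d) → inj₂ (∈-++⁺ʳ (partners N x) d) })
    where open State S

  drop-covered : ∀ {j N w ds} → State q E (suc m) j N (w ∷ ds) → Covers N w ⊎ count (class q E j 0 w) < q
    → State q E (suc m) j N ds
  drop-covered {j} {N} {w} {ds} S c = record { State S ; D-short = ≤-trans (ℕₚ.n≤1+n _) (State.D-short S) ; N-saturates = sat }
    where
    sat : ∀ z → Covers N z ⊎ (z ∈ ds ⊎ count (class q E j 0 z) < q)
    sat z with State.N-saturates S z
    ... | inj₁ p = inj₁ p
    ... | inj₂ (inj₁ (here refl)) = Sum.map₂ inj₂ c
    ... | inj₂ (inj₁ (there d)) = inj₂ (inj₁ d)
    ... | inj₂ (inj₂ lt) = inj₂ (inj₂ lt)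

  -- The end is closed with `N` unchanged: since colour `k` is absent at `w`, classes 0 and `k`
  -- together have at most q edges there, and `advance` can treat `w` as an ordinary vertex.
  drop-unmatched : ∀ {j N w ds} → State q E (suc m) j N (w ∷ ds) → (∀ v → M w v ≡ false) → q ≤ count (class q E j 0 w)
    → ∃ λ j' → Move q E j j' × State q E (suc m) j' N ds
  drop-unmatched {j} {N} {w} {ds} S unM full =
    advance q 3≤q sE aE lumped k 1≤k k≤m N ds N-symmetric N-matching
      (λ u v p → ∨-left (N-⊆ u v p)) (≤-trans (ℕₚ.n≤1+n _) D-short) sat
    where
    open State S
    colour-k = missing-colour lumped w unM full
    k = proj₁ colour-k
    1≤k = proj₁ (proj₂ colour-k)
    k≤m = proj₁ (proj₂ (proj₂ colour-k))
    none = proj₂ (proj₂ (proj₂ colour-k))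
    sat : ∀ z → Covers N z ⊎ (z ∈ ds ⊎ count (zero-and q E j k z) ≤ q)
    sat z with N-saturates z
    ... | inj₁ p = inj₁ p
    ... | inj₂ (inj₁ (there d)) = inj₂ (inj₁ d)
    ... | inj₂ (inj₂ lt) = inj₂ (inj₂ (≤-trans (zero-and-degree q sE lumped k 1≤k z) lt))
    ... | inj₂ (inj₁ (here refl)) = inj₂ (inj₂ (≤-trans
            (count-mono {P = zero-and q E j k w} {Q = class q E j 0 w} λ v p → [ (λ r → r) , (λ r → true≢false r (none v)) ]′ (∨-elim {class q E j 0 w v} p))
            (Lumped.j-small lumped w)))

  -- Terminates lexicographically: a patch lowers the number of disagreements with `M`, after which
  -- the list may be replaced; every other step shortens the list.
  run : ∀ b D {j N} → size (N △ M) ≤ b → State q E (suc m) j N D → Installed j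
  run-after : ∀ b {j N} → size (N △ M) ≤ b → Progress j N → Installed j

  run b [] {j} {N} le S with search₂ (N △ M)
  ... | inj₂ same = finish S λ u v → xor-false (N u v) (M u v) (same u v)
  ... | inj₁ (z , y , d) = run-after b {N = N} le (start-patch S z y (xor-true (N z y) (M z y) d))
  run b (w ∷ ds) {j} {N} le S with covers? N w | covers? M w | ℕₚ.<-≤-connex (count (class q E j 0 w)) q
  ... | inj₁ c   | _               | _         = run b ds le (drop-covered S (inj₁ c))
  ... | inj₂ unN | inj₁ (x , Mwx) | _         = run-after b {N = N} le (continue-patch S unN x Mwx)
  ... | inj₂ unN | inj₂ unM       | inj₁ lt   = run b ds le (drop-covered S (inj₂ lt))
  ... | inj₂ unN | inj₂ unM       | inj₂ full =
    let j' , mv , S' = drop-unmatched S unM full in after-move mv (State.lumped S') (run b ds le S')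

  run-after zero le (D' , j' , N' , lt , mv , S') with () ← ≤-trans lt le
  run-after (suc b) le (D' , j' , N' , lt , mv , S') =
    after-move mv (State.lumped S') (run b D' (s≤s⁻¹ (≤-trans lt le)) S')

  install : ∀ {j} → Lumped q E (suc m) j → Installed j
  install {j} J = run _ [] ≤-refl initial
    where
    -- Colour 0 has degree at most q everywhere, so no vertex is exempt and the process starts
    -- without open ends.
    sat = saturating-matching aE [] (≤-trans (s≤s z≤n) 3≤q) (class q E j 0) (class-symmetric q sE J 0)
      (class-edge q E j 0) (λ z → inj₁ (Lumped.j-small J z))
    initial : State q E (suc m) j (proj₁ sat) []
    initial = record
      { lumped = J ; N-symmetric = proj₁ (proj₂ sat) ; N-matching = proj₁ (proj₂ (proj₂ sat))
      ; N-⊆ = proj₁ (proj₂ (proj₂ (proj₂ sat))) ; D-short = z≤n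
      ; N-saturates = λ z → [ (λ lt → inj₂ (inj₂ lt)) , (λ full → inj₁ (proj₂ (proj₂ (proj₂ (proj₂ sat))) z full)) ]′
                              (ℕₚ.<-≤-connex (count (class q E j 0 z)) q) }

-- Connecting lumped colourings by induction on the number of single colours

module _ {n : ℕ} (q : ℕ) where

  -- Provides `M-saturates` for the top class of the target: at a vertex which this class misses,
  -- colour 0 accounts for at most q edges and each of the colours 1 to m for at most one.
  degree-if-top-missing : ∀ {E : EdgeSet n} {m g} → Lumped q E (suc m) g
    → ∀ z → (∀ w → class q E g (suc m) z w ≡ false) → count (E z) ≤ q + m
  degree-if-top-missing {E} {m} {g} G z none = ≤-trans (≤-reflexive (degree-split E (class q E g 0) z))
    (+-mono-≤ (≤-trans (count-mono {P = (E ∩ class q E g 0) z} λ v → ∧-snd {E z v}) (j-small z))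
      (≤-trans (count-injective ((E ∖ class q E g 0) z) (const true) index (λ _ _ → refl) index-injective)
        (count-≤n {m} (const true))))
    where
    open Lumped G
    nonzero : ∀ w → (E ∖ class q E g 0) z w ≡ true → g z w ≢ 0
    nonzero w p e = true≢false (class-intro q E g 0 z w (∧-fst p) e) (not-elim (∧-snd {E z w} p))
    range : ∀ w → (E ∖ class q E g 0) z w ≡ true → ℕ.pred (g z w) < m
    range w p = by-value (g z w) refl
      where
      by-value : ∀ c → g z w ≡ c → ℕ.pred c < m
      by-value zero e = ⊥-elim (nonzero w p e)
      by-value (suc c) e = ℕₚ.≤∧≢⇒< (s≤s⁻¹ (subst (_≤ suc m) e (j-bounded z w (∧-fst p))))
        λ { refl → true≢false (class-intro q E g (suc m) z w (∧-fst p) e) (none w) }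
    index : ∀ w → (E ∖ class q E g 0) z w ≡ true → Fin m
    index w p = fromℕ< (range w p)
    index-injective : ∀ v w p r → index v p ≡ index w r → v ≡ w
    index-injective v w p r e = j-proper z v w (∧-fst p) (∧-fst r)
      (pred-injective (g z v) (g z w) (nonzero v p) (nonzero w r) (Finₚ.fromℕ<-injective _ _ (range v p) (range w r) e)) (nonzero v p)
      where
      pred-injective : ∀ a b → a ≢ 0 → b ≢ 0 → ℕ.pred a ≡ ℕ.pred b → a ≡ b
      pred-injective zero _ a≢0 _ _ = ⊥-elim (a≢0 refl)
      pred-injective (suc a) zero _ b≢0 _ = ⊥-elim (b≢0 refl)
      pred-injective (suc a) (suc b) _ _ e = cong suc e

  strip : ∀ {E M : EdgeSet n} {m j} → Lumped q E (suc m) j → class q E j (suc m) ⊆ M → Lumped q (E ∖ M) m j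
  strip {E} {M} {m} {j} J top = record
    { j-symmetric = λ u v p → j-symmetric u v (∧-fst p)
    ; j-bounded = λ u v p → s≤s⁻¹ (ℕₚ.≤∧≢⇒< (j-bounded u v (∧-fst p))
        λ e → true≢false (top u v (class-intro q E j (suc m) u v (∧-fst p) e)) (not-elim (∧-snd {E u v} p)))
    ; j-proper = λ u v w p r → j-proper u v w (∧-fst p) (∧-fst r)
    ; j-small = λ z → ≤-trans (degree-mono (class q (E ∖ M) j 0) (class q E j 0)
        (λ u v p → class-intro q E j 0 u v (∧-fst (class-edge q (E ∖ M) j 0 u v p)) (class-value q (E ∖ M) j 0 u v p)) z) (j-small z) }
    where open Lumped J

  module Unstrip {E M : EdgeSet n} (sM : Symmetric M) (mM : Matching M) (m : ℕ) where

    extend : (Fin n → Fin n → ℕ) → Fin n → Fin n → ℕ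
    extend h u v = if M u v then suc m else h u v

    extend-in : ∀ h u v → M u v ≡ true → extend h u v ≡ suc m
    extend-in h u v p = cong (λ b → if b then suc m else h u v) p

    extend-out : ∀ h u v → M u v ≡ false → extend h u v ≡ h u v
    extend-out h u v p = cong (λ b → if b then suc m else h u v) p

    extend-lumped : ∀ {h} → Lumped q (E ∖ M) m h → Lumped q E (suc m) (extend h)
    extend-lumped {h} H = record { j-symmetric = symm ; j-bounded = bounded ; j-proper = prop
      ; j-small = λ z → ≤-trans (degree-mono (class q E (extend h) 0) (class q (E ∖ M) h 0) zero-class z) (j-small z) }
      where
      open Lumped H
      symm : ∀ u v → E u v ≡ true → extend h u v ≡ extend h v u
      symm u v e with true⊎false (M u v)
      ... | inj₁ p = trans (extend-in h u v p) (≡-sym (extend-in h v u (sM u v p)))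
      ... | inj₂ p = trans (extend-out h u v p)
        (trans (j-symmetric u v (∧-intro e (not-intro p))) (≡-sym (extend-out h v u (symmetric-false sM u v p))))
      bounded : ∀ u v → E u v ≡ true → extend h u v ≤ suc m
      bounded u v e with true⊎false (M u v)
      ... | inj₁ p = ≤-reflexive (extend-in h u v p)
      ... | inj₂ p = ≤-trans (≤-reflexive (extend-out h u v p)) (ℕₚ.m≤n⇒m≤1+n (j-bounded u v (∧-intro e (not-intro p))))
      not-top : ∀ u v → E u v ≡ true → M u v ≡ false → extend h u v ≢ suc m
      not-top u v e p r = n≮n m (subst (_≤ m) (trans (≡-sym (extend-out h u v p)) r) (j-bounded u v (∧-intro e (not-intro p))))
      prop : ∀ u v w → E u v ≡ true → E u w ≡ true → extend h u v ≡ extend h u w → extend h u v ≢ 0 → v ≡ w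
      prop u v w e f eq ne with true⊎false (M u v) | true⊎false (M u w)
      ... | inj₁ p | inj₁ r = mM u v w p r
      ... | inj₁ p | inj₂ r = ⊥-elim (not-top u w f r (trans (≡-sym eq) (extend-in h u v p)))
      ... | inj₂ p | inj₁ r = ⊥-elim (not-top u v e p (trans eq (extend-in h u w r)))
      ... | inj₂ p | inj₂ r = j-proper u v w (∧-intro e (not-intro p)) (∧-intro f (not-intro r))
        (trans (≡-sym (extend-out h u v p)) (trans eq (extend-out h u w r))) λ z → ne (trans (extend-out h u v p) z)
      zero-class : class q E (extend h) 0 ⊆ class q (E ∖ M) h 0
      zero-class u v p with true⊎false (M u v)
      ... | inj₁ r = ⊥-elim (suc≢0 (trans (≡-sym (extend-in h u v r)) (class-value q E (extend h) 0 u v p)))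
        where
        suc≢0 : suc m ≢ 0
        suc≢0 ()
      ... | inj₂ r = class-intro q (E ∖ M) h 0 u v (∧-intro (class-edge q E (extend h) 0 u v p) (not-intro r))
        (trans (≡-sym (extend-out h u v r)) (class-value q E (extend h) 0 u v p))

    extend-move : ∀ {h h'} → Move q (E ∖ M) h h' → Move q E (extend h) (extend h')
    extend-move {h} {h'} (k , mv) = k , moved
      where
      moved : ∀ u v → E u v ≡ true → extend h u v ≡ extend h' u v ⊎ (ZeroOr k (extend h u v) × ZeroOr k (extend h' u v))
      moved u v e with true⊎false (M u v)
      ... | inj₁ p = inj₁ (trans (extend-in h u v p) (≡-sym (extend-in h' u v p)))
      ... | inj₂ p rewrite extend-out h u v p | extend-out h' u v p = mv u v (∧-intro e (not-intro p))

    extend-moves : ∀ {h g} → (∀ u v → M u v ≡ true → g u v ≡ suc m) → Moves q (E ∖ M) m h g → Moves q E (suc m) (extend h) g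
    extend-moves {h} {g} top (done eq) = done same
      where
      same : ∀ u v → E u v ≡ true → extend h u v ≡ g u v
      same u v e with true⊎false (M u v)
      ... | inj₁ p = trans (extend-in h u v p) (≡-sym (top u v p))
      ... | inj₂ p = trans (extend-out h u v p) (eq u v (∧-intro e (not-intro p)))
    extend-moves top (step mv J r) = step (extend-move mv) (extend-lumped J) (extend-moves top r)

  lumped-connected : 3 ≤ q → ∀ m {E : EdgeSet n} → Symmetric E → EdgeColourable q E
    → ∀ {j g} → Lumped q E m j → Lumped q E m g → Moves q E m j g
  lumped-connected 3≤q zero sE aE J G = done λ u v e →
    trans (n≤0⇒n≡0 (Lumped.j-bounded J u v e)) (≡-sym (n≤0⇒n≡0 (Lumped.j-bounded G u v e)))
  lumped-connected 3≤q (suc m) {E} sE aE {j} {g} J G =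
    let M = class q E g (suc m)
        sM = class-symmetric q sE G (suc m)
        mM = class-matching q sE G (suc m) (s≤s z≤n)
        j' , r , J' , M⊆ , ⊆M = install 3≤q sE aE sM mM (class-edge q E g (suc m)) (degree-if-top-missing G) J
        rest = lumped-connected 3≤q m (∖-symmetric sE sM) (λ F sF F⊆ → aE F sF (λ u v p → ∧-fst (F⊆ u v p)))
                 (strip {M = M} J' ⊆M) (strip {M = M} G (λ _ _ p → p))
        module U = Unstrip {E} sM mM m
        same : ∀ u v → E u v ≡ true → j' u v ≡ U.extend j' u v
        same u v e = [ (λ p → trans (class-value q E j' (suc m) u v (M⊆ u v p)) (≡-sym (U.extend-in j' u v p)))
                     , (λ p → ≡-sym (U.extend-out j' u v p)) ]′ (true⊎false (M u v))
    -- The maps `j'` and `U.extend j'` are equal on edges only, hence the neutral move.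
    in Moves-trans q J' r (step (0 , λ u v e → inj₁ (same u v e)) (U.extend-lumped (strip {M = M} J' ⊆M))
         (U.extend-moves (class-value q E g (suc m)) rest))

-- Translation between colourings of graphs and of edge sets

uip : ∀ {b : Bool} (p r : b ≡ true) → p ≡ r
uip refl refl = refl

-- The field `colour` is defined on all pairs of vertices, a graph colouring only on edges; the
-- default fills the remaining pairs.
totalise : ∀ {n t} → Fin t → (F : EdgeSet n) → (∀ u v → F u v ≡ true → Fin t) → Fin n → Fin n → Fin t
totalise d F f u v = [ f u v , const d ]′ (true⊎false (F u v))

totalise-≡ : ∀ {n t} (d : Fin t) (F : EdgeSet n) f u v (p : F u v ≡ true) → totalise d F f u v ≡ f u v p
totalise-≡ d F f u v p with true⊎false (F u v)
... | inj₁ r = cong (f u v) (uip r p)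
... | inj₂ r = true≢false p r

module _ {n : ℕ} (G : SGraph n) where

  E-symmetric : Symmetric (E G)
  E-symmetric u v p = trans (≡-sym (SGraph.sym G u v)) p

  -- An `Edge` stores its ends in increasing order, while colour functions are applied to them in
  -- either order.
  Ends : Edge G → Fin n → Fin n → Set
  Ends e u v = (eu e ≡ u × ev e ≡ v) ⊎ (eu e ≡ v × ev e ≡ u)

  edge-between : ∀ u v → E G u v ≡ true → Edge G
  edge-between u v p with Finₚ.<-cmp u v
  ... | tri< lt _ _ = edge u v lt p
  ... | tri≈ _ refl _ = true≢false p (irrefl G u)
  ... | tri> _ _ gt = edge v u gt (E-symmetric u v p)

  edge-between-ends : ∀ u v p → Ends (edge-between u v p) u v
  edge-between-ends u v p with Finₚ.<-cmp u v
  ... | tri< lt _ _ = inj₁ (refl , refl)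
  ... | tri≈ _ refl _ = true≢false p (irrefl G u)
  ... | tri> _ _ gt = inj₂ (refl , refl)

  same-edge : ∀ e e' → SameEdge {G = G} e e' → e ≡ e'
  same-edge (edge u v lt p) (edge .u .v lt' p') (refl , refl) = cong₂ (edge u v) (Finₚ.<-irrelevant lt lt') (uip p p')

  ends-unique : ∀ e e' u v → Ends e u v → Ends e' u v → e ≡ e'
  ends-unique e e' u v (inj₁ (a , b)) (inj₁ (c , d)) = same-edge e e' (trans a (≡-sym c) , trans b (≡-sym d))
  ends-unique e e' u v (inj₂ (a , b)) (inj₂ (c , d)) = same-edge e e' (trans a (≡-sym c) , trans b (≡-sym d))
  ends-unique e e' u v (inj₁ (refl , refl)) (inj₂ (c , d)) = ⊥-elim (Finₚ.<-asym (u<v e) (subst₂ Fin._<_ c d (u<v e')))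
  ends-unique e e' u v (inj₂ (refl , refl)) (inj₁ (c , d)) = ⊥-elim (Finₚ.<-asym (u<v e) (subst₂ Fin._<_ c d (u<v e')))

  ends-swap : ∀ e u v → Ends e u v → Ends e v u
  ends-swap e u v = Sum.swap

  ends-adjacent : ∀ e e' u v w → Ends e u v → Ends e' u w → v ≢ w → Adjacent e e'
  ends-adjacent e e' u v w (inj₁ (a , b)) (inj₁ (c , d)) ne =
    (λ s → ne (trans (≡-sym b) (trans (proj₂ s) d))) , inj₁ (trans a (≡-sym c))
  ends-adjacent e e' u v w (inj₁ (a , b)) (inj₂ (c , d)) ne =
    (λ s → ne (trans (≡-sym b) (trans (proj₂ s) (trans d (trans (≡-sym a) (trans (proj₁ s) c)))))) , inj₂ (inj₁ (trans a (≡-sym d)))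
  ends-adjacent e e' u v w (inj₂ (a , b)) (inj₁ (c , d)) ne =
    (λ s → ne (trans (≡-sym a) (trans (proj₁ s) (trans c (trans (≡-sym b) (trans (proj₂ s) d)))))) , inj₂ (inj₂ (inj₁ (trans b (≡-sym c))))
  ends-adjacent e e' u v w (inj₂ (a , b)) (inj₂ (c , d)) ne =
    (λ s → ne (trans (≡-sym a) (trans (proj₁ s) c))) , inj₂ (inj₂ (inj₂ (trans b (≡-sym d))))

  module FromPColoring {t : ℕ} (d : Fin t) (φ : PColoring G t) where

    f : Coloring G t
    f = proj₁ φ

    on-edges : ∀ u v → E G u v ≡ true → Fin t
    on-edges u v p = f (edge-between u v p)

    pair-colour : Fin n → Fin n → Fin t
    pair-colour = totalise d (E G) on-edges

    pair-colour-ends : ∀ e u v → Ends e u v → pair-colour u v ≡ f e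
    pair-colour-ends e u v en = trans (totalise-≡ d (E G) on-edges u v p)
      (cong f (ends-unique (edge-between u v p) e u v (edge-between-ends u v p) en))
      where
      p : E G u v ≡ true
      p = [ (λ { (refl , refl) → adj e }) , (λ { (refl , refl) → E-symmetric _ _ (adj e) }) ]′ en

    fromPColoring : EdgeColouring (E G) t
    fromPColoring = record
      { colour = pair-colour
      ; symmetric = λ u v p → let e = edge-between u v p ; en = edge-between-ends u v p in
          trans (pair-colour-ends e u v en) (≡-sym (pair-colour-ends e v u (ends-swap e u v en)))
      ; proper = λ u v w p r eq → decide u v w p r eq (v Fin.≟ w) }
      where
      decide : ∀ u v w → E G u v ≡ true → E G u w ≡ true → pair-colour u v ≡ pair-colour u w → Dec (v ≡ w) → v ≡ w
      decide u v w p r eq (yes e) = e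
      decide u v w p r eq (no ne) = ⊥-elim (proj₂ φ e e'
        (ends-adjacent e e' u v w (edge-between-ends u v p) (edge-between-ends u w r) ne)
        (trans (≡-sym (pair-colour-ends e u v (edge-between-ends u v p))) (trans eq (pair-colour-ends e' u w (edge-between-ends u w r)))))
        where
        e = edge-between u v p
        e' = edge-between u w r

  toPColoring : ∀ {t} → EdgeColouring (E G) t → PColoring G t
  toPColoring χ = f , prop
    where
    f : Coloring G _
    f e = colour χ (eu e) (ev e)
    prop : Proper f
    prop e@(edge u v lt p) e'@(edge u' v' lt' p') (ns , inj₁ refl) eq = ns (refl , proper χ u v v' p p' eq)
    prop e@(edge u v lt p) e'@(edge u' v' lt' p') (ns , inj₂ (inj₁ refl)) eq
      with refl ← proper χ u v u' p (E-symmetric u' u p') (trans eq (symmetric χ u' u p')) = Finₚ.<-asym lt lt'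
    prop e@(edge u v lt p) e'@(edge u' v' lt' p') (ns , inj₂ (inj₂ (inj₁ refl))) eq
      with refl ← proper χ v u v' (E-symmetric u v p) p' (trans (≡-sym (symmetric χ u v p)) eq) = Finₚ.<-asym lt lt'
    prop e@(edge u v lt p) e'@(edge u' v' lt' p') (ns , inj₂ (inj₂ (inj₂ refl))) eq =
      ns (proper χ v u u' (E-symmetric u v p) (E-symmetric u' v p')
           (trans (≡-sym (symmetric χ u v p)) (trans eq (symmetric χ u' v p'))) , refl)

-- Refining lumped colourings to proper colourings

∣tabulate∣ : ∀ {t} (P : Fin t → Bool) → ∣ Vec.tabulate P ∣ ≡ count P
∣tabulate∣ {zero} P = refl
∣tabulate∣ {suc t} P with P zero
... | true  = cong suc (∣tabulate∣ (P ∘ suc))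
... | false = ∣tabulate∣ (P ∘ suc)

-- `Equiv` is extended at its end, whereas `Moves` is consumed from its beginning.
Equiv-cons : ∀ {n} {G : SGraph n} {t m} {f g h : PColoring G t}
  → DifferAtMost m (proj₁ f) (proj₁ g) → Equiv G t m g h → Equiv G t m f h
Equiv-cons {g = g} d (one d') = more {g = g} (one d) d'
Equiv-cons d (more {g = g'} r d') = more {g = g'} (Equiv-cons d r) d'

module _ {n : ℕ} (G : SGraph n) (q r : ℕ) (3≤q : 3 ≤ q) (aG : EdgeColourable q (E G)) where

  t : ℕ
  t = q + r

  default : Fin t
  default = fromℕ< (≤-trans (≤-trans (s≤s z≤n) 3≤q) (m≤m+n q r))

  -- The first q colours become colour 0.
  lump : Fin t → ℕ
  lump c = suc (toℕ c) ∸ q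

  lump-injective : ∀ c d → lump c ≢ 0 → lump c ≡ lump d → c ≡ d
  lump-injective c d ne eq = Finₚ.toℕ-injective (ℕₚ.suc-injective (ℕₚ.∸-cancelʳ-≡
    (ℕₚ.<⇒≤ (ℕₚ.m∸n≢0⇒n<m ne)) (ℕₚ.<⇒≤ (ℕₚ.m∸n≢0⇒n<m {_} {q} λ e → ne (trans eq e))) eq))

  Refines : Coloring G t → (Fin n → Fin n → ℕ) → Set
  Refines f j = ∀ e → lump (f e) ≡ j (eu e) (ev e)

  lumps : EdgeColouring (E G) t → Fin n → Fin n → ℕ
  lumps χ u v = lump (colour χ u v)

  lumping : ∀ χ → Lumped q (E G) r (lumps χ)
  lumping χ = record
    { j-symmetric = λ u v p → cong lump (symmetric χ u v p)
    ; j-bounded = λ u v p → ≤-trans (ℕₚ.∸-monoˡ-≤ q (Finₚ.toℕ<n (colour χ u v))) (≤-reflexive (ℕₚ.m+n∸m≡n q r))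
    ; j-proper = λ u v w p s eq ne → proper χ u v w p s (lump-injective _ _ ne eq)
    ; j-small = λ z → ≤-trans (count-injective (zero-class z) (const true)
        (λ w p → fromℕ< (low z w p)) (λ _ _ → refl)
        (λ v w p s e → proper χ z v w (class-edge q (E G) (lumps χ) 0 z v p) (class-edge q (E G) (lumps χ) 0 z w s)
          (Finₚ.toℕ-injective (Finₚ.fromℕ<-injective _ _ (low z v p) (low z w s) e))))
        (count-≤n {q} (const true)) }
    where
    zero-class : EdgeSet n
    zero-class = class q (E G) (lumps χ) 0
    low : ∀ z w → zero-class z w ≡ true → toℕ (colour χ z w) < q
    low z w p = ℕₚ.m∸n≡0⇒m≤n (class-value q (E G) (lumps χ) 0 z w p)

  module _ {j : Fin n → Fin n → ℕ} (J : Lumped q (E G) r j) where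
    open Lumped J

    -- This is where A(q) restores the q actual colours hidden in colour 0.
    zero-colouring : EdgeColouring (class q (E G) j 0) q
    zero-colouring = aG (class q (E G) j 0) (class-symmetric q (E-symmetric G) J 0) (class-edge q (E G) j 0) j-small

    unlump : ℕ → Fin q → ℕ
    unlump zero    c = toℕ c
    unlump (suc k) c = q + k

    unlump-< : ∀ k c → k ≤ r → unlump k c < t
    unlump-< zero    c _  = ≤-trans (Finₚ.toℕ<n c) (m≤m+n q r)
    unlump-< (suc k) c le = ≤-trans (≤-reflexive (≡-sym (+-suc q k))) (+-monoʳ-≤ q le)

    lump-unlump : ∀ k c → suc (unlump k c) ∸ q ≡ k
    lump-unlump zero    c = ℕₚ.m≤n⇒m∸n≡0 (Finₚ.toℕ<n c)
    lump-unlump (suc k) c = trans (cong (_∸ q) (≡-sym (+-suc q k))) (ℕₚ.m+n∸m≡n q (suc k))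

    value : Fin n → Fin n → ℕ
    value u v = unlump (j u v) (colour zero-colouring u v)

    on-edges : ∀ u v → E G u v ≡ true → Fin t
    on-edges u v p = fromℕ< (unlump-< (j u v) (colour zero-colouring u v) (j-bounded u v p))

    refined-colour : Fin n → Fin n → Fin t
    refined-colour = totalise default (E G) on-edges

    refined-value : ∀ u v → E G u v ≡ true → toℕ (refined-colour u v) ≡ value u v
    refined-value u v p = trans (cong toℕ (totalise-≡ default (E G) on-edges u v p))
      (Finₚ.toℕ-fromℕ< (unlump-< (j u v) (colour zero-colouring u v) (j-bounded u v p)))

    refined-lump : ∀ u v → E G u v ≡ true → lump (refined-colour u v) ≡ j u v
    refined-lump u v p = trans (cong (λ x → suc x ∸ q) (refined-value u v p)) (lump-unlump (j u v) _)

    value-zero : ∀ u v → j u v ≡ 0 → value u v ≡ toℕ (colour zero-colouring u v)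
    value-zero u v e = cong (λ k → unlump k (colour zero-colouring u v)) e

    refined : EdgeColouring (E G) t
    refined = record { colour = refined-colour ; symmetric = symm ; proper = prop }
      where
      symm : ∀ u v → E G u v ≡ true → refined-colour u v ≡ refined-colour v u
      symm u v p = Finₚ.toℕ-injective (trans (refined-value u v p) (trans (by-case (j u v ℕₚ.≟ 0))
                     (≡-sym (refined-value v u (E-symmetric G u v p)))))
        where
        unlump-nonzero : ∀ k c d → k ≢ 0 → unlump k c ≡ unlump k d
        unlump-nonzero zero c d ne = ⊥-elim (ne refl)
        unlump-nonzero (suc k) c d ne = refl
        by-case : Dec (j u v ≡ 0) → value u v ≡ value v u
        by-case (yes e) = trans (value-zero u v e) (trans (cong toℕ (symmetric zero-colouring u v (class-intro q (E G) j 0 u v p e)))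
          (≡-sym (value-zero v u (trans (≡-sym (j-symmetric u v p)) e))))
        by-case (no ne) = trans (unlump-nonzero (j u v) _ (colour zero-colouring v u) ne)
          (cong (λ k → unlump k (colour zero-colouring v u)) (j-symmetric u v p))
      prop : ∀ u v w → E G u v ≡ true → E G u w ≡ true → refined-colour u v ≡ refined-colour u w → v ≡ w
      prop u v w p s eq with j u v ℕₚ.≟ 0
      ... | no ne = j-proper u v w p s (trans (≡-sym (refined-lump u v p)) (trans (cong lump eq) (refined-lump u w s))) ne
      ... | yes e = proper zero-colouring u v w (class-intro q (E G) j 0 u v p e) (class-intro q (E G) j 0 u w s e')
              (Finₚ.toℕ-injective (trans (≡-sym (trans (refined-value u v p) (value-zero u v e)))
                (trans (cong toℕ eq) (trans (refined-value u w s) (value-zero u w e')))))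
        where
        e' : j u w ≡ 0
        e' = trans (≡-sym (refined-lump u w s)) (trans (cong lump (≡-sym eq)) (trans (refined-lump u v p) e))

  -- The constant q + 1 counts the q colours that lump to 0 and the at most one further colour that
  -- lumps to `k`. The refinements are arbitrary, so successive ones need no coordination.
  move-differ : ∀ {f f' : Coloring G t} {j j'} → Refines f j → Refines f' j' → Move q (E G) j j'
    → DifferAtMost (suc q) f f'
  move-differ {f} {f'} {j} {j'} ρ ρ' (k , mv) = Vec.tabulate P , ≤-trans (≤-reflexive (∣tabulate∣ P)) P-≤ , same
    where
    P : Fin t → Bool
    P c = ⌊ lump c ℕₚ.≟ 0 ⌋ ∨ ⌊ lump c ℕₚ.≟ k ⌋
    P-intro : ∀ c → ZeroOr k (lump c) → P c ≡ true
    P-intro c (inj₁ e) = ∨-left (dec-complete (lump c ℕₚ.≟ 0) e)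
    P-intro c (inj₂ e) = ∨-right {⌊ lump c ℕₚ.≟ 0 ⌋} (dec-complete (lump c ℕₚ.≟ k) e)
    P-elim : ∀ c → P c ≡ true → ZeroOr k (lump c)
    P-elim c p = Sum.map (dec-sound (lump c ℕₚ.≟ 0)) (dec-sound (lump c ℕₚ.≟ k)) (∨-elim {⌊ lump c ℕₚ.≟ 0 ⌋} p)
    Zero : Fin t → Bool
    Zero c = ⌊ lump c ℕₚ.≟ 0 ⌋
    P-≤ : count P ≤ suc q
    P-≤ = ≤-trans (≤-reflexive (trans (count-split P Zero) (+-comm (count (λ c → P c ∧ Zero c)) _))) (+-mono-≤
      (count-≤1 (λ c → P c ∧ not (Zero c)) λ c d p s → lump-injective c d (nonzero c p) (trans (is-k c p) (≡-sym (is-k d s))))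
      (≤-trans (count-injective (λ c → P c ∧ Zero c) (const true) (λ c p → fromℕ< (low c p)) (λ _ _ → refl)
          λ c d p s e → Finₚ.toℕ-injective (Finₚ.fromℕ<-injective _ _ (low c p) (low d s) e))
        (count-≤n {q} (const true))))
      where
      low : ∀ c → P c ∧ Zero c ≡ true → toℕ c < q
      low c p = ℕₚ.m∸n≡0⇒m≤n (dec-sound (lump c ℕₚ.≟ 0) (∧-snd {P c} p))
      nonzero : ∀ c → P c ∧ not (Zero c) ≡ true → lump c ≢ 0
      nonzero c p e = true≢false (dec-complete (lump c ℕₚ.≟ 0) e) (not-elim (∧-snd {P c} p))
      is-k : ∀ c → P c ∧ not (Zero c) ≡ true → lump c ≡ k
      is-k c p = [ (λ e → ⊥-elim (nonzero c p e)) , (λ e → e) ]′ (P-elim c (∧-fst p))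
    same : ∀ c → c Subset.∉ Vec.tabulate P → SameClass f f' c
    same c c∉ e = mk⇔
      (λ { refl → ≡-sym (lump-injective _ _ (untouched ∘ inj₁) (trans (ρ e)
            (trans (agree (λ z _ → untouched (subst (ZeroOr k) (≡-sym (ρ e)) z))) (≡-sym (ρ' e))))) })
      (λ { refl → ≡-sym (lump-injective _ _ (untouched ∘ inj₁) (trans (ρ' e)
            (trans (≡-sym (agree (λ _ z → untouched (subst (ZeroOr k) (≡-sym (ρ' e)) z)))) (≡-sym (ρ e))))) })
      where
      untouched : ¬ ZeroOr k (lump c)
      untouched z = c∉ (lookup⇒[]= c (Vec.tabulate P) (trans (lookup∘tabulate P c) (P-intro c z)))
      agree : (ZeroOr k (j (eu e) (ev e)) → ZeroOr k (j' (eu e) (ev e)) → ⊥) → j (eu e) (ev e) ≡ j' (eu e) (ev e)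
      agree no-move = [ (λ x → x) , (λ { (a , b) → ⊥-elim (no-move a b) }) ]′ (mv (eu e) (ev e) (adj e))

  moves-equiv : ∀ {j g} → Moves q (E G) r j g → ∀ f h → Refines (proj₁ f) j → Refines (proj₁ h) g → Equiv G t (suc q) f h
  -- Refinements of the same lumped colouring may still differ in the q lumped colours; `k` = 0
  -- allows for this.
  moves-equiv (done eq) f h ρ ρ' = one (move-differ {f = proj₁ f} {f' = proj₁ h} ρ ρ' (0 , λ u v p → inj₁ (eq u v p)))
  moves-equiv (step mv J s) f h ρ ρ' =
    Equiv-cons {g = toPColoring G (refined J)}
      (move-differ {f = proj₁ f} {f' = proj₁ (toPColoring G (refined J))} ρ (λ e → refined-lump J (eu e) (ev e) (adj e)) mv)
      (moves-equiv s _ h (λ e → refined-lump J (eu e) (ev e) (adj e)) ρ')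

  all-equivalent : ∀ f h → Equiv G t (suc q) f h
  all-equivalent f h = moves-equiv
    (lumped-connected q 3≤q r (E-symmetric G) aG (lumping (FromPColoring.fromPColoring G default f)) (lumping (FromPColoring.fromPColoring G default h)))
    f h (refines f) (refines h)
    where
    refines : ∀ f → Refines (proj₁ f) (λ u v → lump (FromPColoring.pair-colour G default f u v))
    refines f e = cong lump (≡-sym (FromPColoring.pair-colour-ends G default f e (eu e) (ev e) (inj₁ (refl , refl))))

colourable⇒TransProperty : ∀ {n} (G : SGraph n) q → 3 ≤ q → EdgeColourable q (E G) → TransProperty G (suc q)
colourable⇒TransProperty G q 3≤q aG k _ f h with k ℕₚ.≤? q
-- With at most q colours in all, a single step may change every class.
... | yes k≤q = one (Subset.⊤ , ≤-trans (≤-reflexive (Subsetₚ.∣⊤∣≡n k)) (ℕₚ.m≤n⇒m≤1+n k≤q) , λ c c∉ → ⊥-elim (c∉ Subsetₚ.∈⊤))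
... | no k≰q = subst (λ k → ∀ (f h : PColoring G k) → Equiv G k (suc q) f h)
                 (ℕₚ.m+[n∸m]≡n (ℕₚ.<⇒≤ (≰⇒> k≰q))) (all-equivalent G q (k ∸ q) 3≤q aG) f h

-- Walks and invariant vertex sets

last-step : ∀ {A : Set} {R : A → A → Set} {a z} → Star R a z → a ≡ z ⊎ ∃ λ y → Star R a y × R y z
last-step ε = inj₁ refl
last-step {R = R} (r ◅ rs) with last-step rs
... | inj₁ refl = inj₂ (_ , ε , r)
... | inj₂ (y , s , t) = inj₂ (y , r ◅ s , t)

invariant : ∀ {A : Set} {R : A → A → Set} (X : A → Bool) → (∀ u v → X u ≡ true → R u v → X v ≡ true)
  → ∀ {a z} → X a ≡ true → Star R a z → X z ≡ true
invariant X closed p ε = p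
invariant X closed p (r ◅ rs) = invariant X closed (closed _ _ p r) rs

empty-colouring : ∀ {n q} → Fin q → (F : EdgeSet n) → (∀ u v → F u v ≡ false) → EdgeColouring F q
empty-colouring d F none = record
  { colour = λ _ _ → d ; symmetric = λ _ _ _ → refl ; proper = λ u v w p _ _ → true≢false p (none u v) }

-- König's theorem

module Kempe {n q : ℕ} {F : EdgeSet n} (sF : Symmetric F) (side : Fin n → Bool)
  (bip : ∀ u v → F u v ≡ true → side u ≢ side v) (x y : Fin n) (Fxy : F x y ≡ true)
  (χ : EdgeColouring (F ∖ pair x y) q) (α β : Fin q)
  (α-missing : ∀ w → (F ∖ pair x y) x w ≡ true → colour χ x w ≢ α)
  (β-missing : ∀ w → (F ∖ pair x y) y w ≡ true → colour χ y w ≢ β) where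

  F' : EdgeSet n
  F' = F ∖ pair x y

  sF' : Symmetric F'
  sF' = ∖-symmetric sF (pair-symmetric x y)

  far : Fin n → Bool
  far u = side u xor side x

  far-flips : ∀ u v → F u v ≡ true → far v ≡ not (far u)
  far-flips u v p = flips (side u) (side v) (side x) (bip u v p)
    where
    flips : ∀ a b d → a ≢ b → b xor d ≡ not (a xor d)
    flips true  true  d ne = ⊥-elim (ne refl)
    flips false false d ne = ⊥-elim (ne refl)
    flips true  false true  ne = refl
    flips true  false false ne = refl
    flips false true  d ne = refl

  far-x : far x ≡ false
  far-x = ≡⇒xor {side x} refl

  far-y : far y ≡ true
  far-y = trans (far-flips x y Fxy) (cong not far-x)

  -- An αβ-walk from x leaves vertices on the side of x along β and the others along α.
  leaving : Bool → Fin q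
  leaving s = if s then α else β

  leaving-cases : ∀ s d → d ≡ α ⊎ d ≡ β → d ≡ leaving s ⊎ d ≡ leaving (not s)
  leaving-cases true  d = λ h → h
  leaving-cases false d = Sum.swap

  walk : EdgeSet n
  walk u v = F' u v ∧ (colour χ u v == leaving (far u))

  open Reachable (reachable walk x) renaming (set to X; root to X-x; closed to X-closed)

  walk-edge : ∀ u v → walk u v ≡ true → F' u v ≡ true
  walk-edge u v = ∧-fst

  walk-colour : ∀ u v → walk u v ≡ true → colour χ u v ≡ leaving (far u)
  walk-colour u v p = ==-sound (∧-snd {F' u v} p)

  -- Bipartiteness enters here: a walk changes sides at every step, so the side of `z` determines
  -- the colour by which it is entered.
  arrived : ∀ z → X z ≡ true → z ≡ x ⊎ ∃ λ u → X u ≡ true × F' z u ≡ true × colour χ z u ≡ leaving (not (far z))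
  arrived z p with last-step (path z p)
  ... | inj₁ e = inj₁ (≡-sym e)
  ... | inj₂ (u , s , r) = inj₂ (u , invariant X X-closed X-x s , sF' u z (walk-edge u z r)
      , trans (≡-sym (symmetric χ u z (walk-edge u z r))) (trans (walk-colour u z r)
          (cong leaving (far-flips z u (sF u z (∧-fst (walk-edge u z r)))))))

  -- Of the two colours at `u`, one continues the walk and the other belongs to the edge by which
  -- `u` was entered; at `x`, the latter colour is `α`, which is missing.
  X-component : ∀ u v → X u ≡ true → F' u v ≡ true → colour χ u v ≡ α ⊎ colour χ u v ≡ β → X v ≡ true
  X-component u v p r ab with leaving-cases (far u) (colour χ u v) ab
  ... | inj₁ e = X-closed u v p (∧-intro r (==-complete e))
  ... | inj₂ e with arrived u p
  ...   | inj₁ refl = ⊥-elim (α-missing v r (trans e (cong (leaving ∘ not) far-x)))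
  ...   | inj₂ (w , q , s , e') = subst (λ w → X w ≡ true) (proper χ u w v s r (trans e' (≡-sym e))) q

  -- Lying on the far side, `y` could be entered only along `β`, which is missing there.
  y∉X : X y ≡ false
  y∉X = false-intro λ p → excluded (arrived y p)
    where
    excluded : (y ≡ x ⊎ ∃ λ u → X u ≡ true × F' y u ≡ true × colour χ y u ≡ leaving (not (far y))) → ⊥
    excluded (inj₁ e) = true≢false (trans (≡-sym (cong far e)) far-y) far-x
    excluded (inj₂ (u , _ , s , e)) = β-missing u s (trans e (cong (leaving ∘ not) far-y))

  swapped : Fin n → Fin n → Fin q
  swapped u v = if X u then swap α β (colour χ u v) else colour χ u v

  swapped-in : ∀ u v → X u ≡ true → swapped u v ≡ swap α β (colour χ u v)
  swapped-in u v p = cong (λ b → if b then swap α β (colour χ u v) else colour χ u v) p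

  swapped-out : ∀ u v → X u ≡ false → swapped u v ≡ colour χ u v
  swapped-out u v p = cong (λ b → if b then swap α β (colour χ u v) else colour χ u v) p

  boundary : ∀ u v → F' u v ≡ true → X u ≡ true → X v ≡ false → swap α β (colour χ u v) ≡ colour χ u v
  boundary u v r p s = swap-other α β _
    (λ e → true≢false (X-component u v p r (inj₁ e)) s) (λ e → true≢false (X-component u v p r (inj₂ e)) s)

  swapped-symmetric : ∀ u v → F' u v ≡ true → swapped u v ≡ swapped v u
  swapped-symmetric u v r with true⊎false (X u) | true⊎false (X v)
  ... | inj₁ p | inj₁ s = trans (swapped-in u v p) (trans (cong (swap α β) (symmetric χ u v r)) (≡-sym (swapped-in v u s)))
  ... | inj₂ p | inj₂ s = trans (swapped-out u v p) (trans (symmetric χ u v r) (≡-sym (swapped-out v u s)))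
  ... | inj₁ p | inj₂ s = trans (swapped-in u v p) (trans (boundary u v r p s) (trans (symmetric χ u v r) (≡-sym (swapped-out v u s))))
  ... | inj₂ p | inj₁ s = trans (swapped-out u v p) (trans (symmetric χ u v r)
      (trans (≡-sym (boundary v u (sF' u v r) s p)) (≡-sym (swapped-in v u s))))

  swapped-proper : ∀ u v w → F' u v ≡ true → F' u w ≡ true → swapped u v ≡ swapped u w → v ≡ w
  swapped-proper u v w r s e with true⊎false (X u)
  ... | inj₁ p = proper χ u v w r s (swap-injective α β (trans (≡-sym (swapped-in u v p)) (trans e (swapped-in u w p))))
  ... | inj₂ p = proper χ u v w r s (trans (≡-sym (swapped-out u v p)) (trans e (swapped-out u w p)))

  -- The exchange turns the colour `α` missing at `x` into `β`, and leaves `β` missing at `y`, which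
  -- is outside `X`.
  swapped-free : ∀ u v w → pair x y u v ≡ true → F' u w ≡ true → swapped u w ≢ β
  swapped-free u v w p r e with pair-elim x y u v p
  ... | inj₁ (refl , _) = α-missing w r (swap-injective α β (trans (≡-sym (swapped-in x w X-x)) (trans e (≡-sym (swap-left α β)))))
  ... | inj₂ (refl , _) = β-missing w r (trans (≡-sym (swapped-out y w y∉X)) e)

  final : Fin n → Fin n → Fin q
  final u v = if pair x y u v then β else swapped u v

  final-new : ∀ u v → pair x y u v ≡ true → final u v ≡ β
  final-new u v p = cong (λ b → if b then β else swapped u v) p

  final-old : ∀ u v → pair x y u v ≡ false → final u v ≡ swapped u v
  final-old u v p = cong (λ b → if b then β else swapped u v) p

  extended : EdgeColouring F q
  extended = record { colour = final ; symmetric = symm ; proper = prop }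
    where
    symm : ∀ u v → F u v ≡ true → final u v ≡ final v u
    symm u v r with true⊎false (pair x y u v)
    ... | inj₁ p = trans (final-new u v p) (≡-sym (final-new v u (pair-symmetric x y u v p)))
    ... | inj₂ p = trans (final-old u v p) (trans (swapped-symmetric u v (∧-intro r (not-intro p)))
                     (≡-sym (final-old v u (symmetric-false (pair-symmetric x y) u v p))))
    prop : ∀ u v w → F u v ≡ true → F u w ≡ true → final u v ≡ final u w → v ≡ w
    prop u v w r s e with true⊎false (pair x y u v) | true⊎false (pair x y u w)
    ... | inj₁ p | inj₁ t = pair-matching x y u v w p t
    ... | inj₁ p | inj₂ t = ⊥-elim (swapped-free u v w p (∧-intro s (not-intro t))
        (trans (≡-sym (final-old u w t)) (trans (≡-sym e) (final-new u v p))))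
    ... | inj₂ p | inj₁ t = ⊥-elim (swapped-free u w v t (∧-intro r (not-intro p))
        (trans (≡-sym (final-old u v p)) (trans e (final-new u w t))))
    ... | inj₂ p | inj₂ t = swapped-proper u v w (∧-intro r (not-intro p)) (∧-intro s (not-intro t))
        (trans (≡-sym (final-old u v p)) (trans e (final-old u w t)))

kempe-extension : ∀ {n q} {F : EdgeSet n} → Symmetric F → (side : Fin n → Bool)
  → (∀ u v → F u v ≡ true → side u ≢ side v) → (∀ z → count (F z) ≤ q)
  → ∀ x y → F x y ≡ true → EdgeColouring (F ∖ pair x y) q → EdgeColouring F q
kempe-extension {F = F} sF side bip small x y Fxy χ =
  let α , α-missing = missing χ x (≤-trans (degree-∖-< F (pair x y) x y Fxy (pair-left x y)) (small x))
      β , β-missing = missing χ y (≤-trans (degree-∖-< F (pair x y) y x (sF x y Fxy) (pair-right x y)) (small y))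
  in Kempe.extended sF side bip x y Fxy χ α β α-missing β-missing

konig : ∀ {n q} → Fin q → (side : Fin n → Bool) → ∀ b (F : EdgeSet n) → size F ≤ b → Symmetric F
  → (∀ u v → F u v ≡ true → side u ≢ side v) → (∀ z → count (F z) ≤ q) → EdgeColouring F q
konig d side b F le sF bip small with search₂ F
... | inj₂ none = empty-colouring d F none
konig d side zero F le sF bip small | inj₁ (x , y , p) = ⊥-elim (<⇒≱ (size-≥1 {F = F} x y p) le)
konig d side (suc b) F le sF bip small | inj₁ (x , y , p) = kempe-extension sF side bip small x y p
  (konig d side b (F ∖ pair x y)
    (s≤s⁻¹ (≤-trans (size-mono-< {F = F ∖ pair x y} {H = F} (∖-⊆ F (pair x y)) x y
      (trans (cong (λ b → F x y ∧ not b) (pair-left x y)) (cong (_∧ false) p)) p) le))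
    (∖-symmetric sF (pair-symmetric x y)) (λ u v r → bip u v (∧-fst r))
    (λ z → ≤-trans (degree-∖-≤ F (pair x y) z) (small z)))

-- Gluing two colourings at a cutvertex

-- A colour `c` in both sets is counted twice, so their union has fewer than q elements and some `d`
-- lies in neither. Transposing `c` and `d` in `B` shrinks the intersection, and this is iterated.
separate : ∀ {q} b (A B : Fin q → Bool) → count (λ c → A c ∧ B c) ≤ b → count A + count B ≤ q
  → ∃ λ (π : Fin q → Fin q) → (∀ {c d} → π c ≡ π d → c ≡ d) × (∀ c → B c ≡ true → A (π c) ≡ false)
separate {q} b A B le room with search (λ c → A c ∧ B c)
... | inj₂ none = (λ c → c) , (λ e → e) , λ c p → false-intro λ r → true≢false (∧-intro r p) (none c)
separate {q} zero A B le room | inj₁ (c , p) = ⊥-elim (<⇒≱ (count-≥1 (λ c → A c ∧ B c) c p) le)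
separate {q} (suc b) A B le room | inj₁ (c , p) =
  let π , inj , avoids = separate b A B' (s≤s⁻¹ (≤-trans fewer le)) (≤-trans (+-monoʳ-≤ (count A) B'≤B) room)
  in π ∘ swap c d , (λ e → swap-injective c d (inj e))
   , λ e Be → avoids (swap c d e) (trans (cong B (swap-involutive c d e)) Be)
  where
  union-< : count (λ e → A e ∨ B e) < q
  union-< = ≤-trans (s≤s (≤-trans (≤-reflexive (count-split (λ e → A e ∨ B e) A))
      (+-mono-≤ (count-mono {P = λ e → (A e ∨ B e) ∧ A e} λ e → ∧-snd {A e ∨ B e}) ≤-refl)))
    (≤-trans (≤-reflexive (≡-sym (+-suc (count A) _)))
    (≤-trans (+-monoʳ-≤ (count A) (count-mono-< {P = λ e → (A e ∨ B e) ∧ not (A e)} {Q = B}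
        (λ e r → [ (λ a → true≢false a (not-elim (∧-snd {A e ∨ B e} r))) , (λ b → b) ]′ (∨-elim {A e} (∧-fst r))) c
        (false-intro λ r → true≢false (∧-fst p) (not-elim (∧-snd {A c ∨ B c} r))) (∧-snd {A c} p))) room))
  free : ∃ λ d → A d ∨ B d ≡ false
  free = count-missing (λ e → A e ∨ B e) union-<
  d = proj₁ free
  B' : Fin q → Bool
  B' e = B (swap c d e)
  B'≤B : count B' ≤ count B
  B'≤B = count-injective B' B (λ e _ → swap c d e) (λ e r → r) (λ _ _ _ _ e → swap-injective c d e)
  A-d : A d ≡ false
  A-d = false-intro λ r → true≢false (∨-left {b = B d} r) (proj₂ free)
  B-d : B d ≡ false
  B-d = false-intro λ r → true≢false (∨-right {A d} r) (proj₂ free)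
  fewer : count (λ e → A e ∧ B' e) < count (λ e → A e ∧ B e)
  fewer = count-mono-< {P = λ e → A e ∧ B' e} smaller c
    (false-intro λ r → true≢false (trans (≡-sym (cong B (swap-left c d))) (∧-snd {A c} r)) B-d) p
    where
    smaller : ∀ e → A e ∧ B' e ≡ true → A e ∧ B e ≡ true
    smaller e r = by-case (e Fin.≟ c) (e Fin.≟ d)
      where
      by-case : Dec (e ≡ c) → Dec (e ≡ d) → A e ∧ B e ≡ true
      by-case (yes refl) _ = p
      by-case (no _) (yes refl) = true≢false (∧-fst r) A-d
      by-case (no e≢c) (no e≢d) =
        ∧-intro (∧-fst r) (trans (≡-sym (cong B (swap-other c d e e≢c e≢d))) (∧-snd {A e} r))

touching : ∀ {n} → (Fin n → Bool) → EdgeSet n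
touching R u w = R u ∨ R w

touching-symmetric : ∀ {n} (R : Fin n → Bool) → Symmetric (touching R)
touching-symmetric R u w p = [ ∨-right {R w} , ∨-left ]′ (∨-elim {R u} p)

-- The edges touching `inner` share only the vertex `cut` with the other edges. Disconnected edge
-- sets fit as well, with a nominal `cut`. The two sample edges make both parts strictly smaller
-- than `P`.
record Separation {n : ℕ} (P : EdgeSet n) : Set where
  field
    inner    : Fin n → Bool
    cut      : Fin n
    cut-out  : inner cut ≡ false
    guarded  : ∀ u w → inner u ≡ true → P u w ≡ true → inner w ≡ true ⊎ w ≡ cut
    in-edge  : ∃₂ λ u w → P u w ≡ true × touching inner u w ≡ true
    out-edge : ∃₂ λ u w → P u w ≡ true × touching inner u w ≡ false

module Glue {n q : ℕ} {F : EdgeSet n} (sF : Symmetric F) (small : ∀ z → count (F z) ≤ q)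
  (R : Fin n → Bool) (cut : Fin n) (guarded : ∀ u w → R u ≡ true → F u w ≡ true → R w ≡ true ⊎ w ≡ cut)
  (χ₁ : EdgeColouring (F ∩ touching R) q) (χ₂ : EdgeColouring (F ∖ touching R) q) where

  -- The degree of `cut` in `F` is the sum of its degrees in the two parts, so the two colour sets
  -- at `cut` have at most q elements together.
  renaming-exists = separate q (present χ₁ cut) (present χ₂ cut) (count-≤n _)
    (≤-trans (+-mono-≤ (present≤degree χ₁ cut) (present≤degree χ₂ cut))
      (≤-trans (≤-reflexive (≡-sym (degree-split F (touching R) cut))) (small cut)))

  π : Fin q → Fin q
  π = proj₁ renaming-exists

  π-injective : ∀ {c d} → π c ≡ π d → c ≡ d
  π-injective = proj₁ (proj₂ renaming-exists)

  glued : Fin n → Fin n → Fin q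
  glued u v = if touching R u v then colour χ₁ u v else π (colour χ₂ u v)

  glued-in : ∀ u v → touching R u v ≡ true → glued u v ≡ colour χ₁ u v
  glued-in u v p = cong (λ b → if b then colour χ₁ u v else π (colour χ₂ u v)) p

  glued-out : ∀ u v → touching R u v ≡ false → glued u v ≡ π (colour χ₂ u v)
  glued-out u v p = cong (λ b → if b then colour χ₁ u v else π (colour χ₂ u v)) p

  mixed : ∀ u v w → F u v ≡ true → F u w ≡ true → touching R u v ≡ true → touching R u w ≡ false
    → colour χ₁ u v ≢ π (colour χ₂ u w)
  mixed u v w r s p t e with ∨-elim {R u} p
  ... | inj₁ Ru = true≢false (∨-left {b = R w} Ru) t
  ... | inj₂ Rv with guarded v u Rv (sF u v r)
  ...   | inj₁ Ru = true≢false (∨-left {b = R w} Ru) t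
  ...   | inj₂ refl = true≢false (subst (λ c → present χ₁ u c ≡ true) e (present-intro χ₁ u v (∧-intro r p)))
                        (proj₂ (proj₂ renaming-exists) _ (present-intro χ₂ u w (∧-intro s (not-intro t))))

  glue : EdgeColouring F q
  glue = record { colour = glued ; symmetric = symm ; proper = prop }
    where
    symm : ∀ u v → F u v ≡ true → glued u v ≡ glued v u
    symm u v r with true⊎false (touching R u v)
    ... | inj₁ p = trans (glued-in u v p) (trans (symmetric χ₁ u v (∧-intro r p)) (≡-sym (glued-in v u (touching-symmetric R u v p))))
    ... | inj₂ p = trans (glued-out u v p) (trans (cong π (symmetric χ₂ u v (∧-intro r (not-intro p))))
                     (≡-sym (glued-out v u (symmetric-false (touching-symmetric R) u v p))))
    prop : ∀ u v w → F u v ≡ true → F u w ≡ true → glued u v ≡ glued u w → v ≡ w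
    prop u v w r s e with true⊎false (touching R u v) | true⊎false (touching R u w)
    ... | inj₁ p | inj₁ t = proper χ₁ u v w (∧-intro r p) (∧-intro s t) (trans (≡-sym (glued-in u v p)) (trans e (glued-in u w t)))
    ... | inj₁ p | inj₂ t = ⊥-elim (mixed u v w r s p t (trans (≡-sym (glued-in u v p)) (trans e (glued-out u w t))))
    ... | inj₂ p | inj₁ t = ⊥-elim (mixed u w v s r t p (trans (≡-sym (glued-in u w t)) (trans (≡-sym e) (glued-out u v p))))
    ... | inj₂ p | inj₂ t = proper χ₂ u v w (∧-intro r (not-intro p)) (∧-intro s (not-intro t))
                              (π-injective (trans (≡-sym (glued-out u v p)) (trans e (glued-out u w t))))

glue-colourable : ∀ {n q} {P : EdgeSet n} (S : Separation P) → let R = Separation.inner S in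
  EdgeColourable q (P ∩ touching R) → EdgeColourable q (P ∖ touching R) → EdgeColourable q P
glue-colourable {P = P} S a₁ a₂ F sF F⊆P small =
  Glue.glue sF small R cut (λ u w p r → guarded u w p (F⊆P u w r))
    (a₁ (F ∩ touching R) (∩-symmetric sF (touching-symmetric R)) (λ u v p → ∧-intro (F⊆P u v (∧-fst p)) (∧-snd {F u v} p))
      λ z → ≤-trans (count-mono {P = (F ∩ touching R) z} λ _ → ∧-fst) (small z))
    (a₂ (F ∖ touching R) (∖-symmetric sF (touching-symmetric R)) (λ u v p → ∧-intro (F⊆P u v (∧-fst p)) (∧-snd {F u v} p))
      λ z → ≤-trans (degree-∖-≤ F (touching R) z) (small z))
  where
  open Separation S renaming (inner to R)

-- Blocks

degree-count : ∀ {n} (G : SGraph n) v → deg G v ≡ count (E G v)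
degree-count {n} G v = along (λ i → i)
  where
  along : ∀ {m} (h : Fin m → Fin n)
    → sum (map (λ u → if E G v u then 1 else 0) (tabulate h)) ≡ count (λ i → E G v (h i))
  along {zero}  h = refl
  along {suc m} h = cong (bit (E G v (h zero)) +_) (along (h ∘ suc))

MaxDeg-≤ : ∀ {n q} (G : SGraph n) → (∀ z → count (E G z) ≤ q) → MaxDeg G ≤ q
MaxDeg-≤ {n} {q} G small = along (allFin n)
  where
  along : ∀ xs → foldr _⊔_ 0 (map (deg G) xs) ≤ q
  along [] = z≤n
  along (x ∷ xs) = ℕₚ.⊔-lub (≤-trans (≤-reflexive (degree-count G x)) (small x)) (along xs)

support : ∀ {n} → EdgeSet n → Fin n → Bool
support F z = [ const true , const false ]′ (covers? F z)

support-intro : ∀ {n} (F : EdgeSet n) z w → F z w ≡ true → support F z ≡ true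
support-intro F z w p with covers? F z
... | inj₁ _ = refl
... | inj₂ none = true≢false p (none w)

support-elim : ∀ {n} (F : EdgeSet n) z → support F z ≡ true → Covers F z
support-elim F z p with covers? F z
... | inj₁ c = c

module _ {n : ℕ} (G : SGraph n) where

  -- With the support as vertex set there are no isolated vertices: two vertices that cannot be
  -- joined always supply edges on both sides of a separation.
  spanned : (F : EdgeSet n) → Symmetric F → F ⊆ E G → SGraph n
  spanned F sF F⊆G = record
    { V = support F ; E = F ; sym = λ u v → ⇔→≡ (mk⇔ (sF u v) (sF v u))
    ; irrefl = λ v → false-intro λ p → true≢false (F⊆G v v p) (irrefl G v)
    ; closed = support-intro F }

  spanned-⊆G : ∀ F sF F⊆G → spanned F sF F⊆G ⊆G G
  spanned-⊆G F sF F⊆G = (λ v p → let w , r = support-elim F v p in closed G v w (F⊆G v w r)) , F⊆G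

InA⇒colourable : ∀ {n q} (B : SGraph n) → Fin q → InA q B → EdgeColourable q (E B)
InA⇒colourable B d inA F sF F⊆B small =
  FromPColoring.fromPColoring H d (inA H (spanned-⊆G B F sF F⊆B) (MaxDeg-≤ H small))
  where H = spanned B F sF F⊆B

Bipartite⇒colourable : ∀ {n q} (B : SGraph n) → Fin q → Bipartite B → EdgeColourable q (E B)
Bipartite⇒colourable B d (side , bip) F sF F⊆B small =
  konig d side _ F ≤-refl sF (λ u v p → bip u v (F⊆B u v p)) small

module _ {n : ℕ} {P : EdgeSet n} (sP : Symmetric P) where

  separation : (R : Fin n → Bool) (c : Fin n) → R c ≡ false
    → (∀ u w → R u ≡ true → P u w ≡ true → R w ≡ true ⊎ w ≡ c)
    → ∀ a → R a ≡ true → support P a ≡ true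
    → ∀ b → R b ≡ false → support P b ≡ true → (∀ w → R w ≡ true → P w b ≡ true → ⊥)
    → Separation P
  separation R c c-out guarded a Ra Pa b Rb Pb far = record
    { inner = R ; cut = c ; cut-out = c-out ; guarded = guarded
    ; in-edge = let w , p = support-elim P a Pa in a , w , p , ∨-left Ra
    ; out-edge = let w , p = support-elim P b Pb in b , w , p , ∨-false Rb (false-intro λ r → far w r (sP b w p)) }

  joined : ∀ a b → (support P a ≡ true → support P b ≡ true → Star (λ u v → P u v ≡ true) a b) ⊎ Separation P
  joined a b with true⊎false (support P a) | true⊎false (support P b)
  ... | inj₂ p | _ = inj₁ λ r _ → true≢false r p
  ... | inj₁ _ | inj₂ p = inj₁ λ _ r → true≢false r p
  -- No edge leaves the component of `a`, so `b` can act as the nominal `cut`.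
  ... | inj₁ Pa | inj₁ Pb = [ (λ p → inj₁ λ _ _ → path b p) , (λ p → inj₂ (separation set b p
        (λ u w s r → inj₁ (reach-closed u w s r)) a root Pa b p Pb λ w s r → true≢false (reach-closed w b s r) p)) ]′ (true⊎false (set b))
    where open Reachable (reachable P a) renaming (closed to reach-closed)

  Avoiding : Fin n → Fin n → Fin n → Set
  Avoiding v a b = P a b ≡ true × a ≢ v × b ≢ v

  -- If `b` cannot be reached from `a` while avoiding `v`, the vertices that can be reached form the
  -- inner side of a separation at `v`.
  joined-avoiding : ∀ v a b → (support P a ≡ true → support P b ≡ true → a ≢ v → b ≢ v → Star (Avoiding v) a b) ⊎ Separation P
  joined-avoiding v a b with true⊎false (support P a) | true⊎false (support P b) | a Fin.≟ v | b Fin.≟ v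
  ... | inj₂ p | _ | _ | _ = inj₁ λ r _ _ _ → true≢false r p
  ... | inj₁ _ | inj₂ p | _ | _ = inj₁ λ _ r _ _ → true≢false r p
  ... | inj₁ _ | inj₁ _ | yes e | _ = inj₁ λ _ _ ne _ → ⊥-elim (ne e)
  ... | inj₁ _ | inj₁ _ | no _ | yes e = inj₁ λ _ _ _ ne → ⊥-elim (ne e)
  ... | inj₁ Pa | inj₁ Pb | no a≢v | no b≢v = [ (λ p → inj₁ λ _ _ _ _ → Star.map (λ {u} {w} → avoid-elim u w) (path b p))
      , (λ p → inj₂ (separation set v v-out guarded a root Pa b p Pb
          λ w s r → [ (λ t → true≢false t p) , b≢v ]′ (guarded w b s r))) ]′ (true⊎false (set b))
    where
    avoid : EdgeSet n
    avoid u w = P u w ∧ (not (u == v) ∧ not (w == v))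
    avoid-elim : ∀ u w → avoid u w ≡ true → Avoiding v u w
    avoid-elim u w p = ∧-fst p
      , (λ e → true≢false (==-complete e) (not-elim (∧-fst (∧-snd {P u w} p))))
      , (λ e → true≢false (==-complete e) (not-elim (∧-snd {not (u == v)} (∧-snd {P u w} p))))
    open Reachable (reachable avoid a) renaming (closed to reach-closed)
    v-out : set v ≡ false
    v-out = false-intro λ p → [ a≢v , (λ { (y , _ , r) → proj₂ (proj₂ (avoid-elim y v r)) refl }) ]′ (last-step (path v p))
    guarded : ∀ u w → set u ≡ true → P u w ≡ true → set w ≡ true ⊎ w ≡ v
    guarded u w s r with w Fin.≟ v
    ... | yes e = inj₂ e
    ... | no w≢v = inj₁ (reach-closed u w s (∧-intro r (∧-intro
          (not-intro (≢⇒==-false λ { refl → true≢false s v-out })) (not-intro (≢⇒==-false w≢v)))))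

blocklike? : ∀ {n} (G : SGraph n) P sP P⊆G → BlockLike (spanned G P sP P⊆G) ⊎ Separation P
blocklike? G P sP P⊆G with finite-choice (λ a → finite-choice (joined sP a))
                         | finite-choice (λ v → finite-choice (λ a → finite-choice (joined-avoiding sP v a)))
... | inj₂ S | _ = inj₂ S
... | inj₁ _ | inj₂ S = inj₂ S
... | inj₁ conn | inj₁ nocut = inj₁ (conn , λ v _ a b → nocut v a b)

-- The edge `c d` has both ends outside `inner` and, being no loop, an end other than `cut`. A walk
-- in `H` to it from `inner` that avoids `cut` would have to stay inside; such a walk exists by
-- `NoCutvertex`, or by connectedness if `cut` is not a vertex of `H`.
blocklike-unseparated : ∀ {n} {P : EdgeSet n} (S : Separation P) (H : SGraph n) → BlockLike H → E H ⊆ P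
  → ∀ a b → E H a b ≡ true → touching (Separation.inner S) a b ≡ true
  → ∀ c d → E H c d ≡ true → touching (Separation.inner S) c d ≡ false → ⊥
blocklike-unseparated {P = P} S H (conn , nocut) H⊆P a b Hab ab c d Hcd cd =
  [ (λ Ra → end a b Ra Hab) , (λ Rb → end b a Rb (sH a b Hab)) ]′ (∨-elim {R a} ab)
  where
  open Separation S renaming (inner to R)
  sH : Symmetric (E H)
  sH = E-symmetric H
  unreached : ∀ z → R z ≡ false → V H z ≡ true → z ≢ cut → ∀ u → R u ≡ true → V H u ≡ true → ⊥
  unreached z Rz Vz z≢cut u Ru Vu with true⊎false (V H cut)
  ... | inj₁ Vc = true≢false (invariant R (λ s t Rs (Hst , _ , t≢cut) →
                    [ (λ x → x) , (λ e → ⊥-elim (t≢cut e)) ]′ (guarded s t Rs (H⊆P s t Hst)))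
                    Ru (nocut cut Vc u z Vu Vz (λ { refl → true≢false Ru cut-out }) z≢cut)) Rz
  ... | inj₂ Vc = true≢false (invariant R (λ s t Rs Hst →
                    [ (λ x → x) , (λ { refl → true≢false (closed H t s (sH s t Hst)) Vc }) ]′ (guarded s t Rs (H⊆P s t Hst)))
                    Ru (conn u z Vu Vz)) Rz
  R-c : R c ≡ false
  R-c = false-intro λ r → true≢false (∨-left {b = R d} r) cd
  R-d : R d ≡ false
  R-d = false-intro λ r → true≢false (∨-right {R c} r) cd
  end : ∀ u w → R u ≡ true → E H u w ≡ true → ⊥
  end u w Ru Huw with c Fin.≟ cut
  ... | no c≢cut = unreached c R-c (closed H c d Hcd) c≢cut u Ru (closed H u w Huw)
  ... | yes refl = unreached d R-d (closed H d c (sH c d Hcd)) (λ { refl → true≢false Hcd (irrefl H d) }) u Ru (closed H u w Huw)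

module _ {n : ℕ} (G : SGraph n) where

  -- The invariant of the decomposition. It refers to subgraphs of `G`, not of `P`, so that a piece
  -- which cannot be separated any more is maximal in `G` and hence one of its blocks.
  UnionOfBlocks : EdgeSet n → Set
  UnionOfBlocks P = ∀ H → BlockLike H → H ⊆G G → ∀ a b → E H a b ≡ true → P a b ≡ true → E H ⊆ P

  inner-union : ∀ {P} → UnionOfBlocks P → (S : Separation P) → UnionOfBlocks (P ∩ touching (Separation.inner S))
  inner-union {P} uP S H bH H⊆G a b Hab p c d Hcd = ∧-intro (H⊆P c d Hcd)
    (¬-not λ out → blocklike-unseparated S H bH H⊆P a b Hab (∧-snd {P a b} p) c d Hcd out)
    where H⊆P = uP H bH H⊆G a b Hab (∧-fst p)

  outer-union : ∀ {P} → UnionOfBlocks P → (S : Separation P) → UnionOfBlocks (P ∖ touching (Separation.inner S))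
  outer-union {P} uP S H bH H⊆G a b Hab p c d Hcd = ∧-intro (H⊆P c d Hcd)
    (not-intro (false-intro λ inn → blocklike-unseparated S H bH H⊆P c d Hcd inn a b Hab (not-elim (∧-snd {P a b} p))))
    where H⊆P = uP H bH H⊆G a b Hab (∧-fst p)

  -- A blocklike extension shares the edge `x y` with `P`, so the invariant confines its edges to
  -- `P`; each of its vertices is `x` or starts a walk to `x`, and thus lies in the support.
  blocklike-union-block : ∀ {P} sP P⊆G → UnionOfBlocks P → ∀ x y → P x y ≡ true
    → BlockLike (spanned G P sP P⊆G) → IsBlock G (spanned G P sP P⊆G)
  blocklike-union-block {P} sP P⊆G uP x y Pxy bP = spanned-⊆G G P sP P⊆G , bP , λ H P⊆H H⊆G bH →
    let H⊆P = uP H bH H⊆G x y (proj₂ P⊆H x y Pxy) Pxy in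
    (λ v Vv → in-support H H⊆P (proj₁ bH v x Vv (proj₁ P⊆H x (support-intro P x y Pxy)))) , H⊆P
    where
    in-support : ∀ H → E H ⊆ P → ∀ {v} → Star (Step H) v x → support P v ≡ true
    in-support H H⊆P ε = support-intro P x y Pxy
    in-support H H⊆P {v} (r ◅ _) = support-intro P v _ (H⊆P v _ r)

  module _ {q : ℕ} (d : Fin q) (blocks : ∀ B → IsBlock G B → EdgeColourable q (E B)) where

    -- Replaces a block tree by repeated separation: pieces that can be separated are glued back
    -- from smaller ones, and the others are blocks.
    union-colourable : ∀ b P → size P ≤ b → Symmetric P → P ⊆ E G → UnionOfBlocks P → EdgeColourable q P
    union-colourable b P le sP P⊆G uP with search₂ P
    ... | inj₂ none = λ F sF F⊆P _ → empty-colouring d F λ u v → false-intro λ p → true≢false (F⊆P u v p) (none u v)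
    ... | inj₁ (x , y , Pxy) with blocklike? G P sP P⊆G
    ...   | inj₁ bP = blocks (spanned G P sP P⊆G) (blocklike-union-block sP P⊆G uP x y Pxy bP)
    union-colourable zero P le sP P⊆G uP | inj₁ (x , y , Pxy) | inj₂ S = ⊥-elim (<⇒≱ (size-≥1 {F = P} x y Pxy) le)
    union-colourable (suc b) P le sP P⊆G uP | inj₁ (x , y , Pxy) | inj₂ S = glue-colourable S
      (union-colourable b (P ∩ touching R) (s≤s⁻¹ (≤-trans inner-< le)) (∩-symmetric sP (touching-symmetric R))
        (λ u v p → P⊆G u v (∧-fst p)) (inner-union uP S))
      (union-colourable b (P ∖ touching R) (s≤s⁻¹ (≤-trans outer-< le)) (∖-symmetric sP (touching-symmetric R))
        (λ u v p → P⊆G u v (∧-fst p)) (outer-union uP S))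
      where
      open Separation S renaming (inner to R)
      inner-< : size (P ∩ touching R) < size P
      inner-< = let u , v , p , o = out-edge in
        size-mono-< {F = P ∩ touching R} {H = P} (λ _ _ → ∧-fst) u v (false-intro λ t → true≢false (∧-snd {P u v} t) o) p
      outer-< : size (P ∖ touching R) < size P
      outer-< = let u , v , p , i = in-edge in
        size-mono-< {F = P ∖ touching R} {H = P} (λ _ _ → ∧-fst) u v (false-intro λ t → true≢false i (not-elim (∧-snd {P u v} t))) p

    blocks-colourable⇒colourable : EdgeColourable q (E G)
    blocks-colourable⇒colourable = union-colourable _ (E G) ≤-refl (E-symmetric G) (λ _ _ p → p)
      λ H _ H⊆G _ _ _ _ → proj₂ H⊆G

theorem1p1 : (q : ℕ) → 3 ≤ q → ∀ {n} (G : SGraph n) → Class1 G → 5 ≤ MaxDeg G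
    → (∀ B → IsBlock G B → Bipartite B ⊎ (Degenerate (suc q) B × InA q B))
    → TransIndexAtMost G (suc q)
theorem1p1 q 3≤q G _ _ blocks =
  suc q , s≤s (≤-trans (s≤s z≤n) 3≤q) , ≤-refl ,
  colourable⇒TransProperty G q 3≤q (blocks-colourable⇒colourable G d λ B isB →
    [ Bipartite⇒colourable B d , (λ (_ , inA) → InA⇒colourable B d inA) ]′ (blocks B isB))
  where
  d : Fin q
  d = fromℕ< (≤-trans (s≤s z≤n) 3≤q)
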